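{- Let $k$ be an algebraically closed field, let $G$ be a simple $k$-group and let $T\subset G$ be a maximal torus. (1) If $G$ is simply-connected, then a character $\chi\in X^*(T)$ is quasi-constant if and only if $\chi=m\xi$ for some $m\in\mathbf Z$ and some $\xi\in X^*(T)$ which is either minuscule or cominuscule. (2) If $G$ is adjoint, then a cocharacter $\mu\in X_*(T)$ is quasi-constant if and only if $\mu=m\nu$ for some $m\in\mathbf Z$ and some $\nu\in X_*(T)$ which is either minuscule or cominuscule.
   Context: "Simple" means connected semisimple with irreducible root system. "Simply-connected" is in the sense of root data: the $\mathbf Z$-span of the coroots is $X_*(T)$. "Adjoint" means that the roots span $X^*(T)$ over $\mathbf Z$. Let $\Phi\subset X^*(T)$, $\Phi^\vee\subset X_*(T)$ be the roots and coroots, $W$ the Weyl group, $\langle\,,\rangle$ the pairing $X^*(T)\times X_*(T)\to\mathbf Z$ (also extended to $\mathbf Q$-coefficients). A character $\chi\in X^*(T)$ is quasi-constant if for every $\alpha\in\Phi$ with $\langle\chi,\alpha^\vee\rangle\ne 0$ and every $\sigma\in W$ one has $\langle\chi,\sigma\alpha^\vee\rangle/\langle\chi,\alpha^\vee\rangle\in\{ -1,0,1\}$ (here $k$ is algebraically closed, so no Galois action intervenes). A cocharacter $\mu$ is quasi-constant if for every $\alpha\in\Phi$ with $\langle\alpha,\mu\rangle\neq0$ and every $\sigma\in W$ one has $\langle\sigma\alpha,\mu\rangle/\langle\alpha,\mu\rangle\in\{ -1,0,1\}$. $\chi$ is minuscule if $\langle\chi,\alpha^\vee\rangle\in\{ -1,0,1\}$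 for all $\alpha\in\Phi$; $\mu$ is minuscule if $\langle\alpha,\mu\rangle\in\{ -1,0,1\}$ for all $\alpha\in\Phi$ (the same definitions apply to elements of $X^*(T)_{\mathbf Q}$, $X_*(T)_{\mathbf Q}$). For a basis of simple roots $\Delta\subset\Phi$ and $\alpha\in\Delta$, the fundamental weight $\eta(\alpha)\in X^*(T)_{\mathbf Q}$ and fundamental coweight $\eta(\alpha^\vee)\in X_*(T)_{\mathbf Q}$ are defined by $\langle\eta(\alpha),\beta^\vee\rangle=\langle\beta,\eta(\alpha^\vee)\rangle=\delta_{\alpha\beta}$ for $\beta\in\Delta$. A character $\chi$ is cominuscule if there are a basis $\Delta\subset\Phi$ and $\alpha\in\Delta$ with $\chi=\eta(\alpha)$ and $\eta(\alpha^\vee)$ minuscule. A cocharacter $\mu$ is cominuscule if there are a basis $\Delta$ and $\alpha\in\Delta$ with $\mu=\eta(\alpha^\vee)$ and $\eta(\alpha)$ minuscule. -}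

module Defs where

open import Algebra.Module.Bundles using (LeftModule)
open import Algebra.Module.Construct.TensorUnit using () renaming (rawLeftModule to rawTensorUnit)
open import Algebra.Module.Morphism.Structures using (module LeftModuleMorphisms)
import Algebra.Properties.CommutativeMonoid.Sum as Sum
open import Data.Bool.Base using (if_then_else_)
open import Data.Fin.Base using (Fin)
open import Data.Fin.Properties using (_≟_)
open import Data.Fin.Subset using (Subset; _∈_; _∉_; ∁; Empty)
open import Data.Integer.Base as ℤ using (ℤ; 0ℤ; +_)
import Data.Integer.Properties as ℤ
open import Data.List.Base using (List; foldr)
open import Data.Nat.Base using (ℕ; suc; NonZero)
open import Data.Product.Base using (Σ; ∃-syntax; _×_; _,_)
open import Data.Rational.Base as ℚ using (ℚ; 0ℚ; 1ℚ; _÷_)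
open import Data.Sum.Base using (_⊎_)
open import Level using (Level; 0ℓ; _⊔_) renaming (suc to lsuc)
open import Relation.Binary.PropositionalEquality.Core using (_≡_; _≢_)
open import Relation.Nullary.Decidable.Core using (does)

ℤ-Module : (c ℓ : Level) → Set (lsuc (c ⊔ ℓ))
ℤ-Module c ℓ = LeftModule ℤ.+-*-ring c ℓ

∣_∣ : ∀ {c ℓ} → ℤ-Module c ℓ → Set c
∣ M ∣ = LeftModule.Carrierᴹ M

module _ {c ℓ} (M : ℤ-Module c ℓ) where
  open LeftModule M
  open Sum +ᴹ-commutativeMonoid using (sum)

  IsFunctional : (∣ M ∣ → ℤ) → Set (c ⊔ ℓ)
  IsFunctional = LeftModuleMorphisms.IsLeftModuleHomomorphism
    rawLeftModule (rawTensorUnit {R = ℤ.+-*-rawRing})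

  combination : ∀ {n} → (Fin n → ∣ M ∣) → (Fin n → ℤ) → ∣ M ∣
  combination v a = sum (λ i → a i *ₗ v i)

  Spansℤ : ∀ {n} → (Fin n → ∣ M ∣) → Set (c ⊔ ℓ)
  Spansℤ v = ∀ x → ∃[ a ] x ≈ᴹ combination v a

  Spansℚ : ∀ {n} → (Fin n → ∣ M ∣) → Set (c ⊔ ℓ)
  Spansℚ v = ∀ x → ∃[ d ] d ≢ 0ℤ × (∃[ a ] d *ₗ x ≈ᴹ combination v a)

  Independent : ∀ {n} → (Fin n → ∣ M ∣) → Set ℓ
  Independent v = ∀ a → combination v a ≈ᴹ 0ᴹ → ∀ i → a i ≡ 0ℤ

  FreeOfRank : ℕ → Set (c ⊔ ℓ)
  FreeOfRank n = Σ (Fin n → ∣ M ∣) λ e → Spansℤ e × Independent e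

-- M ⊗ ℚ as the localisation of M at ℤ ∖ {0}: the element x ⊗ (1 / suc d) is
-- represented by numerator x and denominator-1 d, without normalisation.
infix 9 _⊗ℚ
record _⊗ℚ {c ℓ} (M : ℤ-Module c ℓ) : Set c where
  constructor fraction
  field
    numerator     : ∣ M ∣
    denominator-1 : ℕ

ι : ∀ {c ℓ} {M : ℤ-Module c ℓ} → ∣ M ∣ → M ⊗ℚ
ι x = fraction x 0

_∈[-1,0,1] : ℚ → Set
q ∈[-1,0,1] = q ≡ ℚ.- 1ℚ ⊎ q ≡ 0ℚ ⊎ q ≡ 1ℚ

δ : ∀ {n} → Fin n → Fin n → ℚ
δ i j = if does (i ≟ j) then 1ℚ else 0ℚ

record PerfectPairing {c ℓ} (X Y : ℤ-Module c ℓ) : Set (c ⊔ ℓ) where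
  private
    module X = LeftModule X
    module Y = LeftModule Y

  field
    ⟨_,_⟩ : ∣ X ∣ → ∣ Y ∣ → ℤ
    linearˡ : ∀ y → IsFunctional X (λ x → ⟨ x , y ⟩)
    linearʳ : ∀ x → IsFunctional Y (λ y → ⟨ x , y ⟩)
    -- Y → Hom(X, ℤ) and X → Hom(Y, ℤ) are bijective.
    separatesˡ : ∀ {y y′} → (∀ x → ⟨ x , y ⟩ ≡ ⟨ x , y′ ⟩) → y Y.≈ᴹ y′
    separatesʳ : ∀ {x x′} → (∀ y → ⟨ x , y ⟩ ≡ ⟨ x′ , y ⟩) → x X.≈ᴹ x′
    representsˡ : ∀ {f} → IsFunctional X f → ∃[ y ] (∀ x → ⟨ x , y ⟩ ≡ f x)
    representsʳ : ∀ {f} → IsFunctional Y f → ∃[ x ] (∀ y → ⟨ x , y ⟩ ≡ f y)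

-- X is X^*(T), Y is X_*(T).  Roots are enumerated without repetition by
-- Fin #Φ, and α ↦ α^∨ is the bijection root i ↦ coroot i.
record RootDatum (c ℓ : Level) : Set (lsuc (c ⊔ ℓ)) where
  field
    X Y     : ℤ-Module c ℓ
    rank    : ℕ
    X-free  : FreeOfRank X rank
    pairing : PerfectPairing X Y

  open PerfectPairing pairing public
  module X = LeftModule X
  module Y = LeftModule Y

  field
    #Φ     : ℕ
    root   : Fin #Φ → ∣ X ∣
    coroot : Fin #Φ → ∣ Y ∣
    root-injective   : ∀ {i j} → root i X.≈ᴹ root j → i ≡ j
    coroot-injective : ∀ {i j} → coroot i Y.≈ᴹ coroot j → i ≡ j

  reflection : Fin #Φ → ∣ X ∣ → ∣ X ∣
  reflection i x = x X.+ᴹ X.-ᴹ (⟨ x , coroot i ⟩ X.*ₗ root i)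

  coreflection : Fin #Φ → ∣ Y ∣ → ∣ Y ∣
  coreflection i y = y Y.+ᴹ Y.-ᴹ (⟨ root i , y ⟩ Y.*ₗ coroot i)

  field
    root-coroot-2       : ∀ i → ⟨ root i , coroot i ⟩ ≡ + 2
    reflection-root     : ∀ i j → ∃[ k ] reflection i (root j) X.≈ᴹ root k
    coreflection-coroot : ∀ i j → ∃[ k ] coreflection i (coroot j) Y.≈ᴹ coroot k

  -- Elements of the Weyl group are given by words in the reflections; every
  -- element has such a word, as reflections are involutions.
  W : Set
  W = List (Fin #Φ)

  infixr 8 _·ˣ_ _·ʸ_
  _·ˣ_ : W → ∣ X ∣ → ∣ X ∣
  σ ·ˣ x = foldr reflection x σ

  _·ʸ_ : W → ∣ Y ∣ → ∣ Y ∣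
  σ ·ʸ y = foldr coreflection y σ

  ⟨_,_⟩ˡ : X ⊗ℚ → ∣ Y ∣ → ℚ
  ⟨ fraction x d , y ⟩ˡ = ⟨ x , y ⟩ ℚ./ suc d

  ⟨_,_⟩ʳ : ∣ X ∣ → Y ⊗ℚ → ℚ
  ⟨ x , fraction y d ⟩ʳ = ⟨ x , y ⟩ ℚ./ suc d

  -- ℚα ∩ Φ = {α, -α} for every root α.
  Reduced : Set ℓ
  Reduced = ∀ i j m n → n ≢ 0ℤ → m X.*ₗ root i X.≈ᴹ n X.*ₗ root j →
            root j X.≈ᴹ root i ⊎ root j X.≈ᴹ X.-ᴹ root i

  Semisimple : Set (c ⊔ ℓ)
  Semisimple = Spansℚ X root

  -- Φ is nonempty and not the union of two nonempty, mutually orthogonal subsets.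
  Irreducible : Set
  Irreducible = NonZero #Φ ×
    (∀ (S : Subset #Φ) →
     (∀ {i j} → i ∈ S → j ∉ S → ⟨ root i , coroot j ⟩ ≡ 0ℤ) →
     Empty S ⊎ Empty (∁ S))

  SimplyConnected : Set (c ⊔ ℓ)
  SimplyConnected = Spansℤ Y coroot

  Adjoint : Set (c ⊔ ℓ)
  Adjoint = Spansℤ X root

  SupportedOn : Subset #Φ → (Fin #Φ → ℤ) → Set
  SupportedOn Δ a = ∀ {i} → i ∉ Δ → a i ≡ 0ℤ

  record IsBasis (Δ : Subset #Φ) : Set (c ⊔ ℓ) where
    field
      independent : ∀ a → SupportedOn Δ a →
                    combination X root a X.≈ᴹ X.0ᴹ → ∀ i → a i ≡ 0ℤ
      same-sign   : ∀ i → ∃[ a ] SupportedOn Δ a ×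
                    root i X.≈ᴹ combination X root a ×
                    ((∀ j → 0ℤ ℤ.≤ a j) ⊎ (∀ j → a j ℤ.≤ 0ℤ))

  -- Each of these two conditions determines η in X ⊗ ℚ, respectively Y ⊗ ℚ,
  -- when the root datum is semisimple.
  IsFundamentalWeight : Subset #Φ → Fin #Φ → X ⊗ℚ → Set
  IsFundamentalWeight Δ i η = ∀ {j} → j ∈ Δ → ⟨ η , coroot j ⟩ˡ ≡ δ i j

  IsFundamentalCoweight : Subset #Φ → Fin #Φ → Y ⊗ℚ → Set
  IsFundamentalCoweight Δ i η = ∀ {j} → j ∈ Δ → ⟨ root j , η ⟩ʳ ≡ δ i j

  QuasiConstantˣ : ∣ X ∣ → Set
  QuasiConstantˣ χ = ∀ i → .{{_ : ℚ.NonZero ⟨ ι χ , coroot i ⟩ˡ}} → ∀ σ →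
    (⟨ ι χ , σ ·ʸ coroot i ⟩ˡ ÷ ⟨ ι χ , coroot i ⟩ˡ) ∈[-1,0,1]

  QuasiConstantʸ : ∣ Y ∣ → Set
  QuasiConstantʸ μ = ∀ i → .{{_ : ℚ.NonZero ⟨ root i , ι μ ⟩ʳ}} → ∀ σ →
    (⟨ σ ·ˣ root i , ι μ ⟩ʳ ÷ ⟨ root i , ι μ ⟩ʳ) ∈[-1,0,1]

  Minusculeˣ : X ⊗ℚ → Set
  Minusculeˣ χ = ∀ i → ⟨ χ , coroot i ⟩ˡ ∈[-1,0,1]

  Minusculeʸ : Y ⊗ℚ → Set
  Minusculeʸ μ = ∀ i → ⟨ root i , μ ⟩ʳ ∈[-1,0,1]

  Cominusculeˣ : ∣ X ∣ → Set (c ⊔ ℓ)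
  Cominusculeˣ χ = ∃[ Δ ] ∃[ i ] IsBasis Δ × i ∈ Δ × IsFundamentalWeight Δ i (ι χ) ×
    (∃[ η ] IsFundamentalCoweight Δ i η × Minusculeʸ η)

  Cominusculeʸ : ∣ Y ∣ → Set (c ⊔ ℓ)
  Cominusculeʸ μ = ∃[ Δ ] ∃[ i ] IsBasis Δ × i ∈ Δ × IsFundamentalCoweight Δ i (ι μ) ×
    (∃[ η ] IsFundamentalWeight Δ i η × Minusculeˣ η)

-- By the existence theorem, over any algebraically closed field the root data
-- of pairs (G, T) with G a simple group and T a maximal torus are, up to
-- isomorphism, exactly these.
record IsSimple {c ℓ} (R : RootDatum c ℓ) : Set (c ⊔ ℓ) where
  open RootDatum R
  field
    reduced     : Reduced
    semisimple  : Semisimple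
    irreducible : Irreducible

{-# OPTIONS --safe #-}

-- Let f be a nonzero quasi-constant function on the coroots (or roots) of an
-- irreducible Φ.  Given α with f(α) ≠ 0, any orbit on which f is not zero
-- contains some β with f(β) ≠ 0 that is not orthogonal to α.  Reflecting two such
-- elements into each other gives a relation between the values of |f| and the
-- lengths of α and β; these relations leave only two possibilities.  Either
-- |f| takes a single nonzero value a, and f / a is minuscule, or |f| takes the
-- values a and 2 a, and |f(α)| (α^∨ , α^∨) is constant where f ≠ 0.  In the second
-- case let F be f or its dual under the invariant form, viewed as a functional
-- on the roots, and choose a chamber on which F is dominant.  The roots with
-- |f| = 2 a are decomposable there, so F = u ≠ 0 on some simple root γ with
-- f = a.  If p is the coefficient of γ, the functionals p and F - u p have
-- product zero on Φ, so by irreducibility F vanishes on the other simple roots.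
module Submission where

open import Defs
open import Algebra.Module.Bundles using (LeftModule)
open import Algebra.Module.Morphism.Structures using (module LeftModuleMorphisms)
open import Data.Bool.Base using (true; false; if_then_else_)
open import Data.Fin.Base using (Fin; zero; suc)
import Data.Fin.Properties as Fin
open import Data.Fin.Permutation using (permutation)
open import Data.Fin.Subset using (Subset; _∈_)
open import Data.Fin.Subset.Properties using (x∉p⇒x∈∁p; _∈?_)
open import Data.Integer.Base as ℤ using (ℤ; 0ℤ; 1ℤ; -1ℤ; +_; _+_; _*_; -_; _-_; _≤_; _<_)
import Data.Integer.Properties as ℤ
open import Data.Integer.Tactic.RingSolver using (solve-∀)
open import Data.List.Base using (List; []; _∷_; foldr; allFin)
open import Data.List.Membership.Propositional.Properties using (∈-allFin)
open import Data.List.Relation.Unary.All as All using (All; []; _∷_)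
open import Data.Nat.Base as ℕ using (ℕ; z≤n; s≤s)
import Data.Nat.Properties as ℕ
open import Data.Product using (∃-syntax; _×_; _,_; proj₁; proj₂)
open import Data.Rational.Base as ℚ using (1ℚ; _÷_)
import Data.Rational.Properties as ℚ
open import Data.Rational.Unnormalised.Base using (mkℚᵘ; *≡*)
open import Data.Sum using (_⊎_)
open import Data.Sum as Sum using (inj₁; inj₂; [_,_]′)
open import Data.Vec.Base using (tabulate)
open import Data.Vec.Properties using (lookup∘tabulate; []=⇒lookup; lookup⇒[]=)
open import Function.Base using (_∘_; id; flip; case_of_)
open import Function.Bundles using (_⇔_; mk⇔; module Equivalence)
open import Level using (_⊔_)
open import Relation.Binary.Definitions using (tri<; tri≈; tri>)
open import Relation.Binary.PropositionalEquality
open import Relation.Nullary using (¬_; Dec; yes; no; does; contradiction)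
open import Relation.Nullary.Decidable
  using (decidable-stable; dec-true; map′; ¬¬-excluded-middle; _×-dec_; _⊎-dec_; ¬?)
open import Relation.Nullary.Negation using (¬¬-map)
open import Algebra.Properties.Semiring.Sum ℤ.+-*-semiring
  using (sum; sum-cong-≗; sum-permute; ∑-comm; ∑-distrib-+; *-distribˡ-sum; *-distribʳ-sum)

-- Integers and finite sums

-- Conversely, let ξ = η(α) with η(α^∨) minuscule. The invariant form carries η(α) to a multiple of
-- η(α^∨), so ⟨ξ , β^∨⟩ (β , β) takes only the values 0 and ±(α , α); lengths are constant on
-- orbits, hence ξ is 0 or ± one number on each orbit. The cocharacter case reads the same identity
-- backwards. The form is computed from the Cartan integers as (x , y) = Σ_β ⟨x , β^∨⟩ ⟨y , β^∨⟩, so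
-- that lengths are integers and duals of lattice elements exist in the lattices after scaling.
-- Simple connectedness, or adjointness, serves to divide by a inside the lattice. In the two-valued
-- case the functional F on the roots has two shapes. For characters it is f times the squared
-- length and takes one positive value u, also at the roots with f = 2 a; only the decomposability
-- of these gives f = a at γ. For cocharacters F = f, with values a and 2 a. A chamber on which F is
-- dominant comes from a regular element that is positive wherever F is; it is kept in the span of
-- the coroots, because the independence of the indecomposable roots is proved there by a norm
-- argument.

infix 4 _∈0±_

_∈0±_ : ℤ → ℤ → Set
x ∈0± y = x ≡ 0ℤ ⊎ x ≡ y ⊎ x ≡ - y

square-nonneg : ∀ x → 0ℤ ≤ x * x
square-nonneg (+ n)      = subst (0ℤ ≤_) (ℤ.pos-* n n) (ℤ.+≤+ z≤n)
square-nonneg ℤ.-[1+ n ] = ℤ.+≤+ z≤n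

square-zero : ∀ {x} → x * x ≡ 0ℤ → x ≡ 0ℤ
square-zero {x} eq with ℤ.i*j≡0⇒i≡0∨j≡0 x eq
... | inj₁ p = p
... | inj₂ p = p

*-nonzero : ∀ {x y} → x ≢ 0ℤ → y ≢ 0ℤ → x * y ≢ 0ℤ
*-nonzero {x} x≢0 y≢0 eq with ℤ.i*j≡0⇒i≡0∨j≡0 x eq
... | inj₁ p = x≢0 p
... | inj₂ p = y≢0 p

*-cancelˡ : ∀ {k} x y → k ≢ 0ℤ → k * x ≡ k * y → x ≡ y
*-cancelˡ {k} x y k≢0 = ℤ.*-cancelˡ-≡ k x y {{ℤ.≢-nonZero k≢0}}

*-nonneg : ∀ {x y} → 0ℤ ≤ x → 0ℤ ≤ y → 0ℤ ≤ x * y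
*-nonneg {x} {y} 0≤x 0≤y =
  subst (_≤ x * y) (ℤ.*-zeroʳ x) (ℤ.*-monoˡ-≤-nonNeg x {{ℤ.nonNegative 0≤x}} 0≤y)

*-pos : ∀ {x y} → 0ℤ < x → 0ℤ < y → 0ℤ < x * y
*-pos {x} {y} 0<x 0<y =
  subst (_< x * y) (ℤ.*-zeroʳ x) (ℤ.*-monoˡ-<-pos x {{ℤ.positive 0<x}} 0<y)

pos⇒≢0 : ∀ {x} → 0ℤ < x → x ≢ 0ℤ
pos⇒≢0 0<x refl = ℤ.<-irrefl refl 0<x

sum-mono : ∀ {n} {f g : Fin n → ℤ} → (∀ i → f i ≤ g i) → sum f ≤ sum g
sum-mono {ℕ.zero}  f≤g = ℤ.≤-refl
sum-mono {ℕ.suc n} f≤g = ℤ.+-mono-≤ (f≤g zero) (sum-mono (f≤g ∘ suc))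

sum-zero : ∀ {n} {f : Fin n → ℤ} → (∀ i → f i ≡ 0ℤ) → sum f ≡ 0ℤ
sum-zero {ℕ.zero}  f≡0 = refl
sum-zero {ℕ.suc n} f≡0 = cong₂ _+_ (f≡0 zero) (sum-zero (f≡0 ∘ suc))

sum-nonneg : ∀ {n} {f : Fin n → ℤ} → (∀ i → 0ℤ ≤ f i) → 0ℤ ≤ sum f
sum-nonneg {n} {f} 0≤f = subst (_≤ sum f) (sum-zero {n} {λ _ → 0ℤ} (λ _ → refl)) (sum-mono 0≤f)

term≤sum : ∀ {n} {f : Fin n → ℤ} → (∀ i → 0ℤ ≤ f i) → ∀ i → f i ≤ sum f
term≤sum {ℕ.suc n} {f} 0≤f zero =
  subst (_≤ sum f) (ℤ.+-identityʳ _) (ℤ.+-monoʳ-≤ (f zero) (sum-nonneg (0≤f ∘ suc)))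
term≤sum {ℕ.suc n} {f} 0≤f (suc i) =
  subst (_≤ sum f) (ℤ.+-identityˡ _) (ℤ.+-mono-≤ (0≤f zero) (term≤sum (0≤f ∘ suc) i))

nonneg-sum-zero : ∀ {n} {f : Fin n → ℤ} → (∀ i → 0ℤ ≤ f i) → sum f ≤ 0ℤ → ∀ i → f i ≡ 0ℤ
nonneg-sum-zero 0≤f ∑≤0 i = ℤ.≤-antisym (ℤ.≤-trans (term≤sum 0≤f i) ∑≤0) (0≤f i)

sum-linear : ∀ {n} x y (f g : Fin n → ℤ) → sum (λ i → x * f i + y * g i) ≡ x * sum f + y * sum g
sum-linear x y f g = trans (∑-distrib-+ (λ i → x * f i) (λ i → y * g i))
  (sym (cong₂ _+_ (*-distribˡ-sum x f) (*-distribˡ-sum y g)))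

sum-reindex : ∀ {n} (f : Fin n → ℤ) {π : Fin n → Fin n} → (∀ i → π (π i) ≡ i) → sum f ≡ sum (f ∘ π)
sum-reindex f {π} involutive = sum-permute f (permutation π π involutive involutive)

-- Reindexing along π: the invariance of a form under the reflection in c
-- determines its values against c.
2*sum≡ : ∀ {n} {f c : Fin n → ℤ} {z} {π : Fin n → Fin n} → (∀ i → π (π i) ≡ i) →
         (∀ i → c (π i) ≡ - c i) → (∀ i → f (π i) ≡ f i - c i * z) →
         + 2 * sum (λ i → f i * c i) ≡ z * sum (λ i → c i * c i)
2*sum≡ {f = f} {c} {z} {π} involutive c∘π f∘π = begin
  + 2 * S                             ≡⟨ double S ⟩
  S + S                               ≡⟨ cong (λ t → S + t) (sum-reindex (λ i → f i * c i) involutive) ⟩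
  S + sum (λ i → f (π i) * c (π i))   ≡⟨ cong (λ t → S + t) (sum-cong-≗ reflected) ⟩
  S + sum (λ i → -1ℤ * (f i * c i) + z * (c i * c i))
    ≡⟨ cong (λ t → S + t) (sum-linear -1ℤ z (λ i → f i * c i) (λ i → c i * c i)) ⟩
  S + (-1ℤ * S + z * N)               ≡⟨ cancel S z N ⟩
  z * N ∎
  where
  open ≡-Reasoning
  S = sum (λ i → f i * c i)
  N = sum (λ i → c i * c i)
  double : ∀ x → + 2 * x ≡ x + x
  double = solve-∀
  cancel : ∀ x y z → x + (-1ℤ * x + y * z) ≡ y * z
  cancel = solve-∀
  expand : ∀ x y z → (x - y * z) * - y ≡ -1ℤ * (x * y) + z * (y * y)
  expand = solve-∀
  reflected : ∀ i → f (π i) * c (π i) ≡ -1ℤ * (f i * c i) + z * (c i * c i)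
  reflected i rewrite c∘π i | f∘π i = expand (f i) (c i) z

∣i∣≡∣j∣⇒i≡±j : ∀ {x y} → ℤ.∣ x ∣ ≡ ℤ.∣ y ∣ → x ≡ y ⊎ x ≡ - y
∣i∣≡∣j∣⇒i≡±j {+ _}         {+ _}         refl = inj₁ refl
∣i∣≡∣j∣⇒i≡±j {+ _}         { ℤ.-[1+ _ ]} refl = inj₂ refl
∣i∣≡∣j∣⇒i≡±j { ℤ.-[1+ _ ]} {+ _}         refl = inj₂ refl
∣i∣≡∣j∣⇒i≡±j { ℤ.-[1+ _ ]} { ℤ.-[1+ _ ]} refl = inj₁ refl

∈0±⇒∣∣≡ : ∀ {x y} → x ∈0± y → x ≢ 0ℤ → ℤ.∣ x ∣ ≡ ℤ.∣ y ∣
∈0±⇒∣∣≡     (inj₁ x≡0)         x≢0 = contradiction x≡0 x≢0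
∈0±⇒∣∣≡     (inj₂ (inj₁ refl)) _   = refl
∈0±⇒∣∣≡ {y = y} (inj₂ (inj₂ refl)) _   = ℤ.∣-i∣≡∣i∣ y

-- x and y are the Cartan integers of the pair u , v.
norm-difference : ∀ {n} (u v : Fin n → ℤ) x y →
  + 2 * sum (λ k → u k * v k) ≡ x * sum (λ k → v k * v k) →
  + 2 * sum (λ k → u k * v k) ≡ y * sum (λ k → u k * u k) →
  sum (λ k → (+ 2 * u k - x * v k) * (+ 2 * u k - x * v k)) ≡ (+ 4 - x * y) * sum (λ k → u k * u k)
norm-difference u v x y eqˣ eqʸ = begin
  sum (λ k → (+ 2 * u k - x * v k) * (+ 2 * u k - x * v k))
    ≡⟨ sum-cong-≗ (λ k → expand x (u k) (v k)) ⟩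
  sum (λ k → 1ℤ * (+ 4 * (u k * u k) + - (+ 4 * x) * (u k * v k)) + x * x * (v k * v k))
    ≡⟨ sum-linear 1ℤ (x * x) (λ k → + 4 * (u k * u k) + - (+ 4 * x) * (u k * v k)) (λ k → v k * v k) ⟩
  1ℤ * sum (λ k → + 4 * (u k * u k) + - (+ 4 * x) * (u k * v k)) + x * x * V
    ≡⟨ cong (λ t → 1ℤ * t + x * x * V) (sum-linear (+ 4) (- (+ 4 * x)) (λ k → u k * u k) (λ k → u k * v k)) ⟩
  1ℤ * (+ 4 * U + - (+ 4 * x) * D) + x * x * V
    ≡⟨ collect x U D V ⟩
  + 4 * U - + 2 * x * (+ 2 * D) + x * (x * V)
    ≡⟨ cong₂ (λ t w → + 4 * U - + 2 * x * t + x * w) eqʸ (trans (sym eqˣ) eqʸ) ⟩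
  + 4 * U - + 2 * x * (y * U) + x * (y * U)
    ≡⟨ cancel x y U ⟩
  (+ 4 - x * y) * U ∎
  where
  open ≡-Reasoning
  U = sum (λ k → u k * u k)
  V = sum (λ k → v k * v k)
  D = sum (λ k → u k * v k)
  expand : ∀ x a b → (+ 2 * a - x * b) * (+ 2 * a - x * b)
                   ≡ 1ℤ * (+ 4 * (a * a) + - (+ 4 * x) * (a * b)) + x * x * (b * b)
  expand = solve-∀
  collect : ∀ x l f m → 1ℤ * (+ 4 * l + - (+ 4 * x) * f) + x * x * m
                      ≡ + 4 * l - + 2 * x * (+ 2 * f) + x * (x * m)
  collect = solve-∀
  cancel : ∀ x y l → + 4 * l - + 2 * x * (y * l) + x * (y * l) ≡ (+ 4 - x * y) * l
  cancel = solve-∀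

∈0±-scale : ∀ k {x y} → x ∈0± y → k * x ∈0± k * y
∈0±-scale k (inj₁ refl)            = inj₁ (ℤ.*-zeroʳ k)
∈0±-scale k (inj₂ (inj₁ refl))     = inj₂ (inj₁ refl)
∈0±-scale k {y = y} (inj₂ (inj₂ refl)) = inj₂ (inj₂ (sym (ℤ.neg-distribʳ-* k y)))

∈0±-cancel : ∀ {k x y} → k ≢ 0ℤ → k * x ∈0± k * y → x ∈0± y
∈0±-cancel {k} {x} k≢0 (inj₁ eq)            = inj₁ (*-cancelˡ x 0ℤ k≢0 (trans eq (sym (ℤ.*-zeroʳ k))))
∈0±-cancel {k} {x} {y} k≢0 (inj₂ (inj₁ eq)) = inj₂ (inj₁ (*-cancelˡ x y k≢0 eq))
∈0±-cancel {k} {x} {y} k≢0 (inj₂ (inj₂ eq)) =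
  inj₂ (inj₂ (*-cancelˡ x (- y) k≢0 (trans eq (ℤ.neg-distribʳ-* k y))))

0<i⇒+∣i∣≡i : ∀ {x} → 0ℤ < x → + ℤ.∣ x ∣ ≡ x
0<i⇒+∣i∣≡i 0<x = ℤ.0≤i⇒+∣i∣≡i (ℤ.<⇒≤ 0<x)

sum-unit : ∀ {n} (i : Fin n) (f : Fin n → ℤ) → sum (λ j → (if does (i Fin.≟ j) then 1ℤ else 0ℤ) * f j) ≡ f i
sum-unit zero    f = trans (cong₂ _+_ (ℤ.*-identityˡ (f zero)) (sum-zero (λ j → ℤ.*-zeroˡ (f (suc j))))) (ℤ.+-identityʳ (f zero))
sum-unit (suc i) f = trans (cong₂ _+_ (ℤ.*-zeroˡ (f zero)) (sum-unit i (f ∘ suc))) (ℤ.+-identityˡ (f (suc i)))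

i≤∣i∣ : ∀ x → x ≤ + ℤ.∣ x ∣
i≤∣i∣ (+ _)      = ℤ.≤-refl
i≤∣i∣ ℤ.-[1+ _ ] = ℤ.-≤+

∣i∣<∣i+j∣ : ∀ {x y} → 0ℤ < x → 0ℤ < y → ℤ.∣ x ∣ ℕ.< ℤ.∣ x + y ∣
∣i∣<∣i+j∣ {ℤ.+[1+ m ]} {ℤ.+[1+ n ]} _ _ = ℕ.m<m+n (ℕ.suc m) (s≤s z≤n)
∣i∣<∣i+j∣ {+ 0} (ℤ.+<+ ()) _
∣i∣<∣i+j∣ {_} {+ 0} _ (ℤ.+<+ ())

∣i∣*∣i∣ : ∀ x → + ℤ.∣ x ∣ * + ℤ.∣ x ∣ ≡ x * x
∣i∣*∣i∣ x = trans (sym (ℤ.pos-* ℤ.∣ x ∣ ℤ.∣ x ∣)) (trans (cong +_ (sym (ℤ.abs-* x x))) (ℤ.0≤i⇒+∣i∣≡i (square-nonneg x)))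

sum-*-sum : ∀ {n} (f g : Fin n → ℤ) → sum f * sum g ≡ sum (λ i → sum (λ j → f i * g j))
sum-*-sum f g = trans (*-distribʳ-sum (sum g) f) (sum-cong-≗ (λ i → *-distribˡ-sum (f i) g))

-- Used to compare, entry by entry, the norm of a combination with the norm of the one whose
-- coefficients are the absolute values.
gram : ∀ {m n} (b : Fin m → ℤ) (c : Fin m → Fin n → ℤ) →
       sum (λ k → sum (λ j → b j * c j k) * sum (λ j → b j * c j k))
       ≡ sum (λ i → sum (λ j → b i * b j * sum (λ k → c i k * c j k)))
gram b c = begin
  sum (λ k → sum (λ j → b j * c j k) * sum (λ j → b j * c j k))
    ≡⟨ sum-cong-≗ (λ k → sum-*-sum (λ j → b j * c j k) (λ j → b j * c j k)) ⟩
  sum (λ k → sum (λ i → sum (λ j → b i * c i k * (b j * c j k))))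
    ≡⟨ ∑-comm (λ k i → sum (λ j → b i * c i k * (b j * c j k))) ⟩
  sum (λ i → sum (λ k → sum (λ j → b i * c i k * (b j * c j k))))
    ≡⟨ sum-cong-≗ (λ i → ∑-comm (λ k j → b i * c i k * (b j * c j k))) ⟩
  sum (λ i → sum (λ j → sum (λ k → b i * c i k * (b j * c j k))))
    ≡⟨ sum-cong-≗ (λ i → sum-cong-≗ (λ j → trans
         (sum-cong-≗ (λ k → shuffle (b i) (c i k) (b j) (c j k)))
         (sym (*-distribˡ-sum (b i * b j) (λ k → c i k * c j k))))) ⟩
  sum (λ i → sum (λ j → b i * b j * sum (λ k → c i k * c j k))) ∎
  where
  open ≡-Reasoning
  shuffle : ∀ x y z w → x * y * (z * w) ≡ x * z * (y * w)
  shuffle = solve-∀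

-- Cartan integers

-- C i j is the Cartan integer ⟨ α_i , α_j^∨ ⟩ and s i j the index of s_{α_i} α_j.
record CartanSystem (n : ℕ) : Set₁ where
  field
    C : Fin n → Fin n → ℤ
    s : Fin n → Fin n → Fin n
    C-diag       : ∀ i → C i i ≡ + 2
    C-sˡ         : ∀ i j k → C (s i j) k ≡ C j k - C j i * C i k
    C-sʳ         : ∀ i j k → C k (s i j) ≡ C k j - C i j * C k i
    s-involutive : ∀ i j → s i (s i j) ≡ j
    reduced      : ∀ {i j} → C i j * C j i ≡ + 4 → j ≡ i ⊎ j ≡ s i i
    irreducible  : ∀ {Q : Fin n → Set} → (∀ i → Dec (Q i)) →
                   (∀ {i j} → Q i → ¬ Q j → C i j ≡ 0ℤ) → ∀ {i} → Q i → ∀ j → Q j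

module Cartan {n} (Φ : CartanSystem n) where
  open CartanSystem Φ

  -- Restrictions of linear functionals to the coroots.
  CorootAdditive : (Fin n → ℤ) → Set
  CorootAdditive f = ∀ i j → f (s i j) ≡ f j - C i j * f i

  -- The squared length (α , α) for the invariant form (x , y) = Σ_β ⟨x , β^∨⟩ ⟨y , β^∨⟩; `form` is
  -- its Gram matrix on the roots.
  L : Fin n → ℤ
  L m = sum (λ k → C m k * C m k)

  form : Fin n → Fin n → ℤ
  form i j = sum (λ k → C i k * C j k)

  additive-neg : ∀ f → CorootAdditive f → ∀ i → f (s i i) ≡ - f i
  additive-neg f add i = begin
    f (s i i)           ≡⟨ add i i ⟩
    f i - C i i * f i   ≡⟨ cong (λ c → f i - c * f i) (C-diag i) ⟩
    f i - + 2 * f i     ≡⟨ identity (f i) ⟩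
    - f i               ∎
    where
    open ≡-Reasoning
    identity : ∀ x → x - + 2 * x ≡ - x
    identity = solve-∀

  row-additive : ∀ i → CorootAdditive (C i)
  row-additive i j k = C-sʳ j k i

  -- This is α^∨ = 2 (α , -) / (α , α), evaluated on `f`: the reflection in `m` permutes the indices
  -- and negates the row of `m`.
  2*pairing : ∀ f → CorootAdditive f → ∀ m → + 2 * sum (λ k → f k * C m k) ≡ f m * L m
  2*pairing f add m = 2*sum≡ {f = f} {C m} {f m} (s-involutive m) reflect (add m)
    where
    open ≡-Reasoning
    identity : ∀ x → x - x * + 2 ≡ - x
    identity = solve-∀
    reflect : ∀ k → C m (s m k) ≡ - C m k
    reflect k = begin
      C m (s m k)             ≡⟨ C-sʳ m k m ⟩
      C m k - C m k * C m m   ≡⟨ cong (λ c → C m k - C m k * c) (C-diag m) ⟩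
      C m k - C m k * + 2     ≡⟨ identity (C m k) ⟩
      - C m k                 ∎

  2*form : ∀ i j → + 2 * form i j ≡ C i j * L j
  2*form i j = 2*pairing (C i) (row-additive i) j

  L-pos : ∀ i → 0ℤ < L i
  L-pos i = ℤ.<-≤-trans (ℤ.+<+ (s≤s z≤n))
    (subst (λ c → c * c ≤ L i) (C-diag i) (term≤sum (λ k → square-nonneg (C i k)) i))

  L≢0 : ∀ i → L i ≢ 0ℤ
  L≢0 i = pos⇒≢0 (L-pos i)

  -- Both sides are 2 (α_i , α_j), and the form is symmetric.
  L-sym : ∀ i j → C j i * L i ≡ C i j * L j
  L-sym i j = begin
    C j i * L i      ≡⟨ 2*form j i ⟨
    + 2 * form j i   ≡⟨ cong (+ 2 *_) (sum-cong-≗ (λ k → ℤ.*-comm (C j k) (C i k))) ⟩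
    + 2 * form i j   ≡⟨ 2*form i j ⟩
    C i j * L j      ∎
    where open ≡-Reasoning

  -- The row of a reflected root is the row of the root, reindexed by the same reflection.
  L-s : ∀ i j → L (s i j) ≡ L j
  L-s i j = trans (sum-cong-≗ (λ k → cong₂ _*_ (swap k) (swap k)))
                  (sym (sum-reindex (λ k → C j k * C j k) (s-involutive i)))
    where
    swap : ∀ k → C (s i j) k ≡ C j (s i k)
    swap k = trans (C-sˡ i j k) (trans (cong (λ c → C j k - c) (ℤ.*-comm (C j i) (C i k))) (sym (C-sʳ i k j)))

  C-zero-sym : ∀ {i j} → C i j ≡ 0ℤ → C j i ≡ 0ℤ
  C-zero-sym {i} {j} Cij≡0 with ℤ.i*j≡0⇒i≡0∨j≡0 (C j i) (trans (L-sym i j) (cong (_* L j) Cij≡0))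
  ... | inj₁ Cji≡0 = Cji≡0
  ... | inj₂ Li≡0  = contradiction Li≡0 (L≢0 i)

  C-prod-nonneg : ∀ i j → 0ℤ ≤ C i j * C j i
  C-prod-nonneg i j = ℤ.*-cancelʳ-≤-pos 0ℤ (C i j * C j i) (L i) {{ℤ.positive (L-pos i)}}
    (subst (0ℤ ≤_) (sym eq) (*-nonneg (square-nonneg (C i j)) (ℤ.<⇒≤ (L-pos j))))
    where
    open ≡-Reasoning
    eq : C i j * C j i * L i ≡ C i j * C i j * L j
    eq = begin
      C i j * C j i * L i     ≡⟨ ℤ.*-assoc (C i j) (C j i) (L i) ⟩
      C i j * (C j i * L i)   ≡⟨ cong (C i j *_) (L-sym i j) ⟩
      C i j * (C i j * L j)   ≡⟨ ℤ.*-assoc (C i j) (C i j) (L j) ⟨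
      C i j * C i j * L j     ∎

  -- Positivity of the norm of 2 α - ⟨ α , β^∨ ⟩ β.
  C-prod≤4 : ∀ i j → C i j * C j i ≤ + 4
  C-prod≤4 i j = ℤ.0≤i-j⇒j≤i (ℤ.*-cancelʳ-≤-pos 0ℤ (+ 4 - C i j * C j i) (L i) {{ℤ.positive (L-pos i)}}
    (subst (0ℤ ≤_)
      (norm-difference (C i) (C j) (C i j) (C j i) (2*form i j) (trans (2*form i j) (sym (L-sym i j))))
      (sum-nonneg (λ k → square-nonneg (+ 2 * C i k - C i j * C j k)))))

  C-neg : ∀ i → C i (s i i) ≡ - + 2
  C-neg i = trans (additive-neg (C i) (row-additive i) i) (cong -_ (C-diag i))

  row-neg : ∀ i k → C (s i i) k ≡ - C i k
  row-neg i k = begin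
    C (s i i) k             ≡⟨ C-sˡ i i k ⟩
    C i k - C i i * C i k   ≡⟨ cong (λ c → C i k - c * C i k) (C-diag i) ⟩
    C i k - + 2 * C i k     ≡⟨ identity (C i k) ⟩
    - C i k                 ∎
    where
    open ≡-Reasoning
    identity : ∀ x → x - + 2 * x ≡ - x
    identity = solve-∀

  C-pos-sym : ∀ {i j} → 0ℤ < C i j → 0ℤ < C j i
  C-pos-sym {i} {j} 0<Cij = ℤ.*-cancelʳ-<-nonNeg (L i) {{ℤ.nonNegative (ℤ.<⇒≤ (L-pos i))}}
    (subst (0ℤ <_) (sym (L-sym i j)) (*-pos 0<Cij (L-pos j)))

  -- Two integers that are at least 2 and have product at most 4 are both 2. Then `reduced` makes
  -- the roots equal or opposite, and opposite roots have Cartan integer -2.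
  acute⇒1 : ∀ {i j} → 0ℤ < C i j → i ≢ j → C i j ≡ 1ℤ ⊎ C j i ≡ 1ℤ
  acute⇒1 {i} {j} 0<Cij i≢j = decide (C i j) (C j i) refl refl 0<Cij (C-pos-sym 0<Cij) (C-prod≤4 i j)
    where
    decide : ∀ x y → C i j ≡ x → C j i ≡ y → 0ℤ < x → 0ℤ < y → x * y ≤ + 4 → x ≡ 1ℤ ⊎ y ≡ 1ℤ
    decide ℤ.+[1+ 0 ] _ _ _ _ _ _ = inj₁ refl
    decide ℤ.+[1+ ℕ.suc _ ] ℤ.+[1+ 0 ] _ _ _ _ _ = inj₂ refl
    decide ℤ.+[1+ 1 ] ℤ.+[1+ 1 ] p q _ _ _ with reduced {i} {j} (cong₂ _*_ p q)
    ... | inj₁ j≡i = contradiction (sym j≡i) i≢j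
    ... | inj₂ refl = contradiction (trans (sym p) (C-neg i)) λ ()
    decide ℤ.+[1+ 1 ] ℤ.+[1+ ℕ.suc (ℕ.suc m) ] _ _ _ _ (ℤ.+≤+ le) =
      contradiction (ℕ.≤-trans (ℕ.*-monoʳ-≤ 2 (s≤s (s≤s (s≤s (z≤n {m}))))) le) λ { (s≤s (s≤s (s≤s (s≤s ())))) }
    decide ℤ.+[1+ ℕ.suc (ℕ.suc m) ] ℤ.+[1+ ℕ.suc m′ ] _ _ _ _ (ℤ.+≤+ le) =
      contradiction (ℕ.≤-trans (ℕ.*-mono-≤ (s≤s (s≤s (s≤s (z≤n {m})))) (s≤s (s≤s (z≤n {m′})))) le) λ { (s≤s (s≤s (s≤s (s≤s ())))) }
    decide (+ 0) _ _ _ (ℤ.+<+ ()) _ _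
    decide _ (+ 0) _ _ _ (ℤ.+<+ ()) _

  -- Roots and coroots exchange roles, so that whatever is shown for functions on the coroots also
  -- applies to cocharacters as functions on the roots.
  dual : CartanSystem n
  dual = record
    { C            = flip C
    ; s            = s
    ; C-diag       = C-diag
    ; C-sˡ         = C-sʳ
    ; C-sʳ         = C-sˡ
    ; s-involutive = s-involutive
    ; reduced      = λ {i} {j} eq → reduced (trans (ℤ.*-comm (C i j) (C j i)) eq)
    ; irreducible  = λ Q? orthogonal → irreducible Q? (λ q ¬q → C-zero-sym (orthogonal q ¬q))
    }

  infixr 8 _·_

  _·_ : List (Fin n) → Fin n → Fin n
  σ · i = foldr s i σ

  L-· : ∀ σ i → L (σ · i) ≡ L i
  L-· []      i = refl
  L-· (j ∷ σ) i = trans (L-s j (σ · i)) (L-· σ i)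

-- Finitely many instances of excluded middle fit under one double negation, so irreducibility can
-- be applied to an undecided predicate when the goal is a negation.
¬¬-decidable : ∀ {n} (Q : Fin n → Set) → ¬ ¬ (∀ i → Dec (Q i))
¬¬-decidable {ℕ.zero}  Q k = k λ ()
¬¬-decidable {ℕ.suc n} Q k = ¬¬-excluded-middle λ q → ¬¬-decidable (Q ∘ suc) λ qs →
  k λ { zero → q ; (suc i) → qs i }

-- Orbits of the Weyl group

module Orbit {n} (Φ : CartanSystem n) where
  open CartanSystem Φ
  open Cartan Φ

  -- Every W-orbit spans, by irreducibility.  The orbits are not known to be
  -- decidable subsets, whence the double negation.
  orbit-meets : ∀ i j → ¬ ¬ (∃[ σ ] C (σ · i) j ≢ 0ℤ)
  orbit-meets i j k = ¬¬-decidable Q λ Q? → k (irreducible Q? orthogonal ([] , Cii≢0) j)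
    where
    Q : Fin n → Set
    Q j = ∃[ σ ] C (σ · i) j ≢ 0ℤ
    Cii≢0 : C i i ≢ 0ℤ
    Cii≢0 eq = contradiction (trans (sym (C-diag i)) eq) λ ()
    vanishes : ∀ {j} → ¬ Q j → ∀ σ → C (σ · i) j ≡ 0ℤ
    vanishes {j} ¬Qj σ = decidable-stable (C (σ · i) j ℤ.≟ 0ℤ) λ ≢0 → ¬Qj (σ , ≢0)
    identity : ∀ x y z → z - x * y + x * y ≡ z
    identity = solve-∀
    -- Both `σ · i` and its reflection in `a` pair to zero with `b`, and these pairings differ by C
    -- (σ · i) a times C a b.
    orthogonal : ∀ {a b} → Q a → ¬ Q b → C a b ≡ 0ℤ
    orthogonal {a} {b} (σ , ≢0) ¬Qb = [ (λ eq → contradiction eq ≢0) , id ]′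
      (ℤ.i*j≡0⇒i≡0∨j≡0 (C (σ · i) a) (begin
        C (σ · i) a * C a b                ≡⟨ ℤ.neg-involutive _ ⟨
        - - (C (σ · i) a * C a b)          ≡⟨ cong -_ (ℤ.+-identityˡ (- (C (σ · i) a * C a b))) ⟨
        - (0ℤ - C (σ · i) a * C a b)       ≡⟨ cong (λ t → - (t - C (σ · i) a * C a b)) (vanishes ¬Qb σ) ⟨
        - (C (σ · i) b - C (σ · i) a * C a b) ≡⟨ cong -_ (C-sˡ a (σ · i) b) ⟨
        - C (s a (σ · i)) b                ≡⟨ cong -_ (vanishes ¬Qb (a ∷ σ)) ⟩
        0ℤ ∎))
      where open ≡-Reasoning

-- Values of quasi-constant functions

-- `a` and `b` are values of |f|, `l` and `m` the squared lengths of the roots. Equal values admit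
-- length ratios 1, 2 and 1/2, while a doubled value comes with a halved squared length.
Related : ℕ → ℕ → ℕ → ℕ → Set
Related a l b m = (a ≡ b × (l ≡ m ⊎ l ≡ 2 ℕ.* m ⊎ 2 ℕ.* l ≡ m))
                ⊎ (a ≡ 2 ℕ.* b × 2 ℕ.* l ≡ m)
                ⊎ (2 ℕ.* a ≡ b × l ≡ 2 ℕ.* m)

pattern same p q    = inj₁ (p , inj₁ q)
pattern longer p q  = inj₁ (p , inj₂ (inj₁ q))
pattern shorter p q = inj₁ (p , inj₂ (inj₂ q))
pattern larger p q  = inj₂ (inj₁ (p , q))
pattern smaller p q = inj₂ (inj₂ (p , q))

related? : ∀ a l b m → Dec (Related a l b m)
related? a l b m =
  (a ℕ.≟ b ×-dec (l ℕ.≟ m ⊎-dec l ℕ.≟ 2 ℕ.* m ⊎-dec 2 ℕ.* l ℕ.≟ m))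
  ⊎-dec (a ℕ.≟ 2 ℕ.* b ×-dec 2 ℕ.* l ℕ.≟ m)
  ⊎-dec (2 ℕ.* a ℕ.≟ b ×-dec l ℕ.≟ 2 ℕ.* m)

factors-of-2 : ∀ m n → m ℕ.* n ≡ 2 → (m ≡ 1 × n ≡ 2) ⊎ (m ≡ 2 × n ≡ 1)
factors-of-2 1 n eq = inj₁ (refl , trans (sym (ℕ.*-identityˡ n)) eq)
factors-of-2 2 n eq = inj₂ (refl , ℕ.*-cancelˡ-≡ n 1 2 eq)
factors-of-2 (ℕ.suc (ℕ.suc (ℕ.suc m))) 0 eq = contradiction (trans (sym (ℕ.*-zeroʳ m)) eq) λ ()
factors-of-2 (ℕ.suc (ℕ.suc (ℕ.suc m))) (ℕ.suc n) eq = contradiction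
  (subst (3 ℕ.≤_) eq (ℕ.*-mono-≤ (s≤s (s≤s (s≤s (z≤n {m})))) (s≤s (z≤n {n})))) λ { (s≤s (s≤s ())) }

square-root-of-4 : ∀ m → m ℕ.* m ≡ 4 → m ≡ 2
square-root-of-4 2 _ = refl
square-root-of-4 (ℕ.suc (ℕ.suc (ℕ.suc m))) eq = contradiction
  (subst (9 ℕ.≤_) eq (ℕ.*-mono-≤ 3≤ 3≤)) λ { (s≤s (s≤s (s≤s (s≤s ())))) }
  where
  3≤ : 3 ℕ.≤ ℕ.suc (ℕ.suc (ℕ.suc m))
  3≤ = s≤s (s≤s (s≤s z≤n))

-- a and b are the values at two coroots with Cartan integers N and M, l and m
-- the norms of the roots.
related : ∀ {a l b m} N M → b ≢ 0 →
          N ℕ.* a ≡ b ⊎ N ℕ.* a ≡ 2 ℕ.* b → M ℕ.* b ≡ a ⊎ M ℕ.* b ≡ 2 ℕ.* a →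
          M ℕ.* l ≡ N ℕ.* m → (N ℕ.* M ≡ 4 → N ≡ M) → Related a l b m
related {a} {l} {b} {m} N M b≢0 = λ
  -- Multiplying the two value relations gives N M = 1, 2, 2 or 4 in the four cases. A product 2
  -- leaves two factorisations, and for product 4 the last hypothesis yields N = M = 2; the lengths
  -- then follow from M l = N m.
  { (inj₁ p) (inj₁ q) r _ →
      let NM≡1 = product 1 (trans (cong (N ℕ.*_) q) (trans p (sym (ℕ.*-identityˡ b))))
          N≡1  = ℕ.m*n≡1⇒m≡1 N M NM≡1
          M≡1  = ℕ.m*n≡1⇒n≡1 N M NM≡1
      in same (at-1 N≡1 p) (at-1 M≡1 (trans r (by N≡1)))
  ; (inj₁ p) (inj₂ q) r _ → case factors-of-2 N M (product 2 (begin
        N ℕ.* (M ℕ.* b)   ≡⟨ cong (N ℕ.*_) q ⟩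
        N ℕ.* (2 ℕ.* a)   ≡⟨ swap N 2 a ⟩
        2 ℕ.* (N ℕ.* a)   ≡⟨ cong (2 ℕ.*_) p ⟩
        2 ℕ.* b           ∎)) of λ
      { (inj₁ (N≡1 , M≡2)) → shorter (at-1 N≡1 p) (trans (at M≡2 r) (by N≡1))
      ; (inj₂ (N≡2 , M≡1)) → smaller (at N≡2 p) (at-1 M≡1 (trans r (cong (ℕ._* m) N≡2))) }
  ; (inj₂ p) (inj₁ q) r _ → case factors-of-2 N M (product 2 (trans (cong (N ℕ.*_) q) p)) of λ
      { (inj₁ (N≡1 , M≡2)) → larger (at-1 N≡1 p) (trans (at M≡2 r) (by N≡1))
      ; (inj₂ (N≡2 , M≡1)) → longer (sym (at-1 M≡1 q)) (at-1 M≡1 (trans r (cong (ℕ._* m) N≡2))) }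
  ; (inj₂ p) (inj₂ q) r N≡M′ →
      let NM≡4 = product 4 (begin
            N ℕ.* (M ℕ.* b)   ≡⟨ cong (N ℕ.*_) q ⟩
            N ℕ.* (2 ℕ.* a)   ≡⟨ swap N 2 a ⟩
            2 ℕ.* (N ℕ.* a)   ≡⟨ cong (2 ℕ.*_) p ⟩
            2 ℕ.* (2 ℕ.* b)   ≡⟨ ℕ.*-assoc 2 2 b ⟨
            4 ℕ.* b           ∎)
          N≡M = N≡M′ NM≡4
          N≡2 = square-root-of-4 N (trans (cong (N ℕ.*_) N≡M) NM≡4)
          M≡2 = trans (sym N≡M) N≡2
      in same (ℕ.*-cancelˡ-≡ a b 2 (at N≡2 p)) (ℕ.*-cancelˡ-≡ l m 2 (trans (at M≡2 r) (cong (ℕ._* m) N≡2))) }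
  where
  open ≡-Reasoning
  product : ∀ k → N ℕ.* (M ℕ.* b) ≡ k ℕ.* b → N ℕ.* M ≡ k
  product k eq = ℕ.*-cancelʳ-≡ (N ℕ.* M) k b {{ℕ.≢-nonZero b≢0}} (trans (ℕ.*-assoc N M b) eq)
  at : ∀ {k c x y} → k ≡ c → k ℕ.* x ≡ y → c ℕ.* x ≡ y
  at refl eq = eq
  at-1 : ∀ {k x y} → k ≡ 1 → k ℕ.* x ≡ y → x ≡ y
  at-1 refl eq = trans (sym (ℕ.*-identityˡ _)) eq
  by : ∀ {k x} → k ≡ 1 → k ℕ.* x ≡ x
  by refl = ℕ.*-identityˡ _
  swap : ∀ x y z → x ℕ.* (y ℕ.* z) ≡ y ℕ.* (x ℕ.* z)
  swap x y z = trans (sym (ℕ.*-assoc x y z)) (trans (cong (ℕ._* z) (ℕ.*-comm x y)) (ℕ.*-assoc y x z))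

distinct : ∀ {A : Set} {x} → x ≢ 0 → ∀ c d → c ≢ d → c ℕ.* x ≡ d ℕ.* x → A
distinct x≢0 c d c≢d eq = contradiction (ℕ.*-cancelʳ-≡ c d _ {{ℕ.≢-nonZero x≢0}} eq) c≢d

-- Once two values in ratio 2 occur, any third one has to be compatible with both. Each remaining
-- combination would equate two different multiples of `a` or of `m`.
third-value : ∀ {e k a l b m} → a ≢ 0 → m ≢ 0 → 2 ℕ.* a ≡ b → l ≡ 2 ℕ.* m →
              Related e k a l → Related e k b m → (e ≡ a × k ≡ l) ⊎ (e ≡ b × k ≡ m)
third-value {e} {k} {a} {_} {_} {m} a≢0 m≢0 refl refl = λ
  { (same p q) _ → inj₁ (p , q)
  ; (longer refl refl) (same p _) → distinct a≢0 1 2 (λ ()) (one p)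
  ; (longer refl refl) (longer p _) → distinct a≢0 1 2 (λ ()) (one p)
  ; (longer refl refl) (shorter p _) → distinct a≢0 1 2 (λ ()) (one p)
  ; (longer refl refl) (larger p _) → distinct a≢0 1 4 (λ ()) (trans (one p) (double 2 a))
  ; (longer refl refl) (smaller _ q) → distinct m≢0 4 2 (λ ()) (trans (sym (double 2 m)) q)
  ; (shorter refl r) (same p _) → distinct a≢0 1 2 (λ ()) (one p)
  ; (shorter refl r) (longer p _) → distinct a≢0 1 2 (λ ()) (one p)
  ; (shorter refl r) (shorter p _) → distinct a≢0 1 2 (λ ()) (one p)
  ; (shorter refl r) (larger p _) → distinct a≢0 1 4 (λ ()) (trans (one p) (double 2 a))
  ; (shorter refl r) (smaller _ q) → distinct m≢0 1 2 (λ ()) (one (trans (sym (ℕ.*-cancelˡ-≡ k m 2 r)) q))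
  ; (larger p q) _ → inj₂ (p , ℕ.*-cancelˡ-≡ k m 2 q)
  ; (smaller p q) (same refl _) → distinct a≢0 4 1 (λ ()) (trans (sym (double 2 a)) (sym (one (sym p))))
  ; (smaller p q) (longer refl _) → distinct a≢0 4 1 (λ ()) (trans (sym (double 2 a)) (sym (one (sym p))))
  ; (smaller p q) (shorter refl _) → distinct a≢0 4 1 (λ ()) (trans (sym (double 2 a)) (sym (one (sym p))))
  ; (smaller p q) (larger refl _) → distinct a≢0 8 1 (λ ())
      (trans (trans (ℕ.*-assoc 2 4 a) (cong (2 ℕ.*_) (ℕ.*-assoc 2 2 a))) (sym (one (sym p))))
  ; (smaller p q) (smaller p′ _) → distinct a≢0 1 2 (λ ())
      (one (trans (sym p) (cong (2 ℕ.*_) (ℕ.*-cancelˡ-≡ e a 2 p′)))) }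
  where
  one : ∀ {x y} → x ≡ y → 1 ℕ.* x ≡ y
  one = trans (ℕ.*-identityˡ _)
  double : ∀ c x → 2 ℕ.* (c ℕ.* x) ≡ (2 ℕ.* c) ℕ.* x
  double c x = sym (ℕ.*-assoc 2 c x)

-- The two kinds of quasi-constant functions

module Dichotomy {n} (Φ : CartanSystem n) where
  open CartanSystem Φ
  open Cartan Φ
  open Orbit Φ

  QuasiConstant : (Fin n → ℤ) → Set
  QuasiConstant f = ∀ i σ → f i ≢ 0ℤ → f (σ · i) ∈0± f i

  -- The criterion behind the converse direction: on one orbit `c` and `N` are constant, so `f` is
  -- confined to 0 and ± N / c there. It is used with c = N = 1 for minuscule elements, and with one
  -- of `c` and `N` equal to `L` and the other constant for cominuscule ones.
  orbit-bound⇒quasi-constant : ∀ (c N : Fin n → ℤ) {f} →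
    (∀ σ i → c (σ · i) ≡ c i) → (∀ σ i → N (σ · i) ≡ N i) → (∀ i → c i ≢ 0ℤ) →
    (∀ i → c i * f i ∈0± N i) → QuasiConstant f
  orbit-bound⇒quasi-constant c N {f} c-invariant N-invariant c≢0 bound i σ fi≢0 =
    case bound i of λ
      { (inj₁ eq)        → contradiction eq (*-nonzero (c≢0 i) fi≢0)
      ; (inj₂ (inj₁ eq)) → ∈0±-cancel (c≢0 i) (subst (c i * f (σ · i) ∈0±_) (sym eq) bound′)
      ; (inj₂ (inj₂ eq)) → flip-sign (∈0±-cancel (c≢0 i) (subst (c i * f (σ · i) ∈0±_)
          (trans (sym (ℤ.neg-involutive (N i))) (trans (cong -_ (sym eq)) (ℤ.neg-distribʳ-* (c i) (f i)))) bound′)) }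
    where
    bound′ : c i * f (σ · i) ∈0± N i
    bound′ = subst₂ (λ a b → a * f (σ · i) ∈0± b) (c-invariant σ i) (N-invariant σ i) (bound (σ · i))
    flip-sign : ∀ {x y} → x ∈0± - y → x ∈0± y
    flip-sign (inj₁ eq)        = inj₁ eq
    flip-sign (inj₂ (inj₁ eq)) = inj₂ (inj₂ eq)
    flip-sign {y = y} (inj₂ (inj₂ eq)) = inj₂ (inj₁ (trans eq (ℤ.neg-involutive y)))

  scale-quasi-constant : ∀ m {f} → QuasiConstant f → QuasiConstant (λ i → m * f i)
  scale-quasi-constant m {f} quasi i σ mfi≢0 =
    ∈0±-scale m (quasi i σ (λ fi≡0 → mfi≢0 (trans (cong (m *_) fi≡0) (ℤ.*-zeroʳ m))))

  quasi-constant-cong : ∀ {f g} → (∀ i → f i ≡ g i) → QuasiConstant f → QuasiConstant g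
  quasi-constant-cong f≡g quasi i σ gi≢0 =
    subst₂ _∈0±_ (f≡g (σ · i)) (f≡g i) (quasi i σ (gi≢0 ∘ trans (sym (f≡g i))))

  Uniform : (Fin n → ℤ) → Set
  Uniform f = ∃[ a ] a ≢ 0ℤ × (∀ k → f k ∈0± a)

  -- `base` carries the smaller absolute value, on the side of the greater `L`. Its sign is fixed so
  -- that `f base` can serve directly as the divisor of `f`.
  record TwoLengths (f : Fin n → ℤ) : Set where
    field
      base        : Fin n
      base-pos    : 0ℤ < f base
      values      : ∀ k → f k ≢ 0ℤ → (ℤ.∣ f k ∣ ≡ ℤ.∣ f base ∣ × L k ≡ L base)
                                   ⊎ (ℤ.∣ f k ∣ ≡ 2 ℕ.* ℤ.∣ f base ∣ × + 2 * L k ≡ L base)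

  module _ (f : Fin n → ℤ) (additive : CorootAdditive f) (quasi : QuasiConstant f) where

    -- Quasi-constancy allows the reflected value f j - C i j * f i to be 0, f j or - f j only, and
    -- f j would make C i j * f i vanish.
    reflected-value : ∀ {i j} → f i ≢ 0ℤ → f j ≢ 0ℤ → C i j ≢ 0ℤ →
                      C i j * f i ≡ f j ⊎ C i j * f i ≡ + 2 * f j
    reflected-value {i} {j} fi≢0 fj≢0 Cij≢0 with subst (_∈0± f j) (additive i j) (quasi j (i ∷ []) fj≢0)
    ... | inj₁ eq = inj₁ (sym (ℤ.i-j≡0⇒i≡j (f j) _ eq))
    ... | inj₂ (inj₁ eq) = contradiction
          (trans (sym (identity (f j) _)) (ℤ.i≡j⇒i-j≡0 (sym eq))) (*-nonzero Cij≢0 fi≢0)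
      where
      identity : ∀ x y → x - (x - y) ≡ y
      identity = solve-∀
    ... | inj₂ (inj₂ eq) = inj₂ (trans (sym (identity (f j) _)) (trans (cong (λ t → f j - t) eq) (double (f j))))
      where
      identity : ∀ x y → x - (x - y) ≡ y
      identity = solve-∀
      double : ∀ x → x - - x ≡ + 2 * x
      double = solve-∀

    adjacent-related : ∀ {i j} → f i ≢ 0ℤ → f j ≢ 0ℤ → C i j ≢ 0ℤ →
                       Related ℤ.∣ f i ∣ ℤ.∣ L i ∣ ℤ.∣ f j ∣ ℤ.∣ L j ∣
    adjacent-related {i} {j} fi≢0 fj≢0 Cij≢0 = related ℤ.∣ C i j ∣ ℤ.∣ C j i ∣ (fj≢0 ∘ ℤ.∣i∣≡0⇒i≡0)
      (absolute (C i j) (f i) (reflected-value fi≢0 fj≢0 Cij≢0))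
      (absolute (C j i) (f j) (reflected-value fj≢0 fi≢0 (Cij≢0 ∘ C-zero-sym)))
      (trans (sym (ℤ.abs-* (C j i) (L i))) (trans (cong ℤ.∣_∣ (L-sym i j)) (ℤ.abs-* (C i j) (L j))))
      symmetric
      where
      absolute : ∀ x y {z} → x * y ≡ z ⊎ x * y ≡ + 2 * z →
                 ℤ.∣ x ∣ ℕ.* ℤ.∣ y ∣ ≡ ℤ.∣ z ∣ ⊎ ℤ.∣ x ∣ ℕ.* ℤ.∣ y ∣ ≡ 2 ℕ.* ℤ.∣ z ∣
      absolute x y {z} = Sum.map (λ eq → trans (sym (ℤ.abs-* x y)) (cong ℤ.∣_∣ eq))
        (λ eq → trans (sym (ℤ.abs-* x y)) (trans (cong ℤ.∣_∣ eq) (ℤ.abs-* (+ 2) z)))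
      -- Product 4 occurs only for equal or opposite roots, whose two Cartan integers coincide.
      symmetric : ℤ.∣ C i j ∣ ℕ.* ℤ.∣ C j i ∣ ≡ 4 → ℤ.∣ C i j ∣ ≡ ℤ.∣ C j i ∣
      symmetric eq with reduced {i} {j} (trans (sym (ℤ.0≤i⇒+∣i∣≡i (C-prod-nonneg i j)))
                                               (cong +_ (trans (ℤ.abs-* (C i j) (C j i)) eq)))
      ... | inj₁ refl = refl
      ... | inj₂ refl = cong ℤ.∣_∣ (trans (C-neg i) (sym (trans (row-neg i i) (cong -_ (C-diag i)))))

    -- Irreducibility provides an orbit member `k` not orthogonal to `j`. If `f` vanishes at `k`,
    -- reflect in `j`: the value becomes - C j k * f j, which is nonzero, and the pairing with `j`
    -- only changes sign.
    orbit-neighbour : ∀ {i j} → f i ≢ 0ℤ → f j ≢ 0ℤ →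
                      ¬ ¬ (∃[ k ] ℤ.∣ f k ∣ ≡ ℤ.∣ f i ∣ × L k ≡ L i × C k j ≢ 0ℤ)
    orbit-neighbour {i} {j} fi≢0 fj≢0 ¬∃ = orbit-meets i j λ (σ , Ckj≢0) → neighbour σ Ckj≢0
      where
      conclude : ∀ σ → f (σ · i) ≢ 0ℤ → C (σ · i) j ≢ 0ℤ → _
      conclude σ fk≢0 Ckj≢0 = ¬∃ (σ · i , ∈0±⇒∣∣≡ (quasi i σ fi≢0) fk≢0 , L-· σ i , Ckj≢0)
      neighbour : ∀ σ → C (σ · i) j ≢ 0ℤ → _
      neighbour σ Ckj≢0 with f (σ · i) ℤ.≟ 0ℤ
      ... | no  fk≢0 = conclude σ fk≢0 Ckj≢0
      ... | yes fk≡0 = conclude (j ∷ σ)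
              (λ eq → *-nonzero (Ckj≢0 ∘ C-zero-sym) fj≢0 (negated eq))
              (λ eq → Ckj≢0 (ℤ.neg-injective (trans (sym reflected) eq)))
        where
        open ≡-Reasoning
        k = σ · i
        negated : f (s j k) ≡ 0ℤ → C j k * f j ≡ 0ℤ
        negated eq = trans (sym (ℤ.i-j≡0⇒i≡j (f k) _ (trans (sym (additive j k)) eq))) fk≡0
        identity : ∀ x → x - x * + 2 ≡ - x
        identity = solve-∀
        reflected : C (s j k) j ≡ - C k j
        reflected = begin
          C (s j k) j               ≡⟨ C-sˡ j k j ⟩
          C k j - C k j * C j j     ≡⟨ cong (λ c → C k j - C k j * c) (C-diag j) ⟩
          C k j - C k j * + 2       ≡⟨ identity (C k j) ⟩
          - C k j                   ∎

    values-related : ∀ {i j} → f i ≢ 0ℤ → f j ≢ 0ℤ → Related ℤ.∣ f i ∣ ℤ.∣ L i ∣ ℤ.∣ f j ∣ ℤ.∣ L j ∣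
    -- `Related` is a decidable statement about four numbers, which removes the double negation
    -- coming from the orbit.
    values-related {i} {j} fi≢0 fj≢0 = decidable-stable (related? _ _ _ _) λ ¬rel →
      orbit-neighbour fi≢0 fj≢0 λ (k , ∣fk∣≡∣fi∣ , Lk≡Li , Ckj≢0) → ¬rel
        (subst₂ (λ a l → Related a ℤ.∣ l ∣ ℤ.∣ f j ∣ ℤ.∣ L j ∣) ∣fk∣≡∣fi∣ Lk≡Li
          (adjacent-related (λ eq → fi≢0 (ℤ.∣i∣≡0⇒i≡0 (trans (sym ∣fk∣≡∣fi∣) (cong ℤ.∣_∣ eq)))) fj≢0 Ckj≢0))

    negate-positive : ∀ {i} → f i ≢ 0ℤ → ∃[ j ] 0ℤ < f j × ℤ.∣ f j ∣ ≡ ℤ.∣ f i ∣ × L j ≡ L i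
    negate-positive {i} fi≢0 with ℤ.<-cmp 0ℤ (f i)
    ... | tri< 0<fi _ _ = i , 0<fi , refl , refl
    ... | tri≈ _ 0≡fi _ = contradiction (sym 0≡fi) fi≢0
    ... | tri> _ _ fi<0 = s i i , subst (0ℤ <_) (sym (additive-neg f additive i)) (ℤ.neg-mono-< fi<0)
                        , trans (cong ℤ.∣_∣ (additive-neg f additive i)) (ℤ.∣-i∣≡∣i∣ (f i)) , L-s i i

    -- The cases are separated by a finite search for two nonzero values in ratio 2. If there are
    -- such, `third-value` excludes all others; if not, `values-related` leaves a single absolute
    -- value.
    dichotomy : Uniform f ⊎ TwoLengths f
    dichotomy with Fin.any? (λ i → Fin.any? (λ j →
      ¬? (f i ℤ.≟ 0ℤ) ×-dec ¬? (f j ℤ.≟ 0ℤ) ×-dec 2 ℕ.* ℤ.∣ f i ∣ ℕ.≟ ℤ.∣ f j ∣))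
    ... | yes (i , j , fi≢0 , fj≢0 , 2fi≡fj) = inj₂ two-lengths
      where
      ∣fi∣≢0 : ℤ.∣ f i ∣ ≢ 0
      ∣fi∣≢0 = fi≢0 ∘ ℤ.∣i∣≡0⇒i≡0
      norms : ∀ {x y} → Related ℤ.∣ f i ∣ x ℤ.∣ f j ∣ y → x ≡ 2 ℕ.* y
      norms = λ
        { (inj₁ (p , _)) → distinct ∣fi∣≢0 1 2 (λ ()) (trans (ℕ.*-identityˡ _) (trans p (sym 2fi≡fj)))
        ; (larger p _)   → distinct ∣fi∣≢0 1 4 (λ ()) (trans (ℕ.*-identityˡ _)
                             (trans p (trans (cong (2 ℕ.*_) (sym 2fi≡fj)) (sym (ℕ.*-assoc 2 2 ℤ.∣ f i ∣)))))
        ; (smaller _ q)  → q }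
      Li≡2Lj : ℤ.∣ L i ∣ ≡ 2 ℕ.* ℤ.∣ L j ∣
      Li≡2Lj = norms (values-related fi≢0 fj≢0)
      +∣L∣ : ∀ k → + ℤ.∣ L k ∣ ≡ L k
      +∣L∣ k = 0<i⇒+∣i∣≡i (L-pos k)
      +2∣L∣ : ∀ k → + (2 ℕ.* ℤ.∣ L k ∣) ≡ + 2 * L k
      +2∣L∣ k = trans (ℤ.pos-* 2 ℤ.∣ L k ∣) (cong (+ 2 *_) (+∣L∣ k))
      two-lengths : TwoLengths f
      two-lengths with (b , 0<fb , ∣fb∣≡∣fi∣ , Lb≡Li) ← negate-positive fi≢0 = record
        { base     = b
        ; base-pos = 0<fb
        ; values   = λ k fk≢0 → case third-value ∣fi∣≢0 (L≢0 j ∘ ℤ.∣i∣≡0⇒i≡0) 2fi≡fj Li≡2Lj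
                                       (values-related fk≢0 fi≢0) (values-related fk≢0 fj≢0) of λ
            { (inj₁ (p , q)) → inj₁ (trans p (sym ∣fb∣≡∣fi∣)
                , trans (trans (sym (+∣L∣ k)) (trans (cong +_ q) (+∣L∣ i))) (sym Lb≡Li))
            ; (inj₂ (p , q)) → inj₂ (trans p (trans (sym 2fi≡fj) (cong (2 ℕ.*_) (sym ∣fb∣≡∣fi∣)))
                , trans (trans (sym (+2∣L∣ k)) (trans (cong (λ t → + (2 ℕ.* t)) q)
                    (trans (cong +_ (sym Li≡2Lj)) (+∣L∣ i)))) (sym Lb≡Li)) }
        }
    ... | no ¬∃ with Fin.any? (λ i → ¬? (f i ℤ.≟ 0ℤ))
    -- For f = 0 any nonzero divisor will do; 1 is taken.
    ...   | no  f≡0 = inj₁ (1ℤ , (λ ()) , λ k → inj₁ (decidable-stable (f k ℤ.≟ 0ℤ) λ fk≢0 → f≡0 (k , fk≢0)))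
    ...   | yes (i , fi≢0) = inj₁ (f i , fi≢0 , value)
      where
      value : ∀ k → f k ∈0± f i
      value k with f k ℤ.≟ 0ℤ
      ... | yes fk≡0 = inj₁ fk≡0
      ... | no  fk≢0 = inj₂ (∣i∣≡∣j∣⇒i≡±j (case values-related fk≢0 fi≢0 of λ
            { (inj₁ (p , _)) → p
            ; (larger p _)  → contradiction (i , k , fi≢0 , fk≢0 , sym p) ¬∃
            ; (smaller p _) → contradiction (k , i , fk≢0 , fi≢0 , p) ¬∃ }))

    module _ (T : TwoLengths f) where
      open TwoLengths T

      positive-values : ∀ k → 0ℤ < f k → (f k ≡ f base × L k ≡ L base)
                                       ⊎ (f k ≡ + 2 * f base × + 2 * L k ≡ L base)
      positive-values k 0<fk with values k (pos⇒≢0 0<fk)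
      ... | inj₁ (p , q) = inj₁ (trans (sym (0<i⇒+∣i∣≡i 0<fk)) (trans (cong +_ p) (0<i⇒+∣i∣≡i base-pos)) , q)
      ... | inj₂ (p , q) = inj₂ (trans (sym (0<i⇒+∣i∣≡i 0<fk)) (trans (cong +_ p)
                                  (trans (ℤ.pos-* 2 ℤ.∣ f base ∣) (cong (+ 2 *_) (0<i⇒+∣i∣≡i base-pos)))) , q)

      up-to-sign : ∀ k → f k ≡ 0ℤ ⊎ 0ℤ < f k ⊎ 0ℤ < f (s k k)
      up-to-sign k with ℤ.<-cmp 0ℤ (f k)
      ... | tri< 0<fk _ _ = inj₂ (inj₁ 0<fk)
      ... | tri≈ _ 0≡fk _ = inj₁ (sym 0≡fk)
      ... | tri> _ _ fk<0 = inj₂ (inj₂ (subst (0ℤ <_) (sym (additive-neg f additive k)) (ℤ.neg-mono-< fk<0)))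

      -- Prepares the division of `f` by its smaller value inside the lattice.
      base∣ : ∀ k → ∃[ w ] f k ≡ w * f base
      base∣ k = case up-to-sign k of λ
        { (inj₁ fk≡0)          → 0ℤ , fk≡0
        ; (inj₂ (inj₁ 0<fk))   → multiple 0<fk
        ; (inj₂ (inj₂ 0<f-k))  → let (w , eq) = multiple 0<f-k in - w ,
            ℤ.neg-injective (trans (sym (additive-neg f additive k)) (trans eq (neg w (f base)))) }
        where
        neg : ∀ x y → x * y ≡ - (- x * y)
        neg = solve-∀
        multiple : ∀ {k} → 0ℤ < f k → ∃[ w ] f k ≡ w * f base
        multiple {k} 0<fk with positive-values k 0<fk
        ... | inj₁ (eq , _) = 1ℤ , trans eq (sym (ℤ.*-identityˡ (f base)))
        ... | inj₂ (eq , _) = + 2 , eq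

      positive-weight : ∀ {k} → 0ℤ < f k → f k * L k ≡ f base * L base
      positive-weight {k} 0<fk with positive-values k 0<fk
      ... | inj₁ (p , q) = cong₂ _*_ p q
      ... | inj₂ (p , q) = trans (cong (_* L k) p) (trans (shuffle (f base) (L k)) (cong (f base *_) q))
        where
        shuffle : ∀ x y → + 2 * x * y ≡ x * (+ 2 * y)
        shuffle = solve-∀

      -- Doubling of `f` is compensated by halving of `L`. As `f * L` is the functional dual to `f`,
      -- this says that the dual is minuscule up to scale.
      weight : ∀ k → f k * L k ∈0± f base * L base
      weight k = case up-to-sign k of λ
        { (inj₁ fk≡0)         → inj₁ (cong (_* L k) fk≡0)
        ; (inj₂ (inj₁ 0<fk))  → inj₂ (inj₁ (positive-weight 0<fk))
        ; (inj₂ (inj₂ 0<f-k)) → inj₂ (inj₂ (ℤ.neg-injective (begin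
            - (f k * L k)               ≡⟨ ℤ.neg-distribˡ-* (f k) (L k) ⟩
            - f k * L k                 ≡⟨ cong₂ _*_ (additive-neg f additive k) (L-s k k) ⟨
            f (s k k) * L (s k k)       ≡⟨ positive-weight 0<f-k ⟩
            f base * L base             ≡⟨ ℤ.neg-involutive (f base * L base) ⟨
            - - (f base * L base)       ∎))) }
        where open ≡-Reasoning

      -- Some `j` with f j = a is not orthogonal to `k`. Then C k j times 2 a is a or 2 a; the first
      -- fails by parity, so C k j = 1, and the ratio of the lengths gives C j k = 2.
      double-neighbour : ∀ {k} → f k ≡ + 2 * f base → + 2 * L k ≡ L base →
                         ¬ ¬ (∃[ j ] f j ≡ f base × C k j ≡ 1ℤ × C j k ≡ + 2)
      double-neighbour {k} fk≡2a 2Lk≡l ¬∃ = orbit-neighbour base≢0 fk≢0 λ (j , ∣fj∣≡a , Lj≡l , Cjk≢0) →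
        case negate (∣i∣≡∣j∣⇒i≡±j ∣fj∣≡a) Lj≡l Cjk≢0 of λ (i , fi≡a , Li≡l , Cik≢0) →
        let Cki≡1 = one i fi≡a (Cik≢0 ∘ C-zero-sym) in
        ¬∃ (i , fi≡a , Cki≡1 , ℤ.*-cancelʳ-≡ (C i k) (+ 2) (L k) {{ℤ.≢-nonZero (L≢0 k)}} (begin
          C i k * L k   ≡⟨ L-sym k i ⟩
          C k i * L i   ≡⟨ cong₂ _*_ Cki≡1 Li≡l ⟩
          1ℤ * L base   ≡⟨ ℤ.*-identityˡ (L base) ⟩
          L base        ≡⟨ 2Lk≡l ⟨
          + 2 * L k     ∎))
        where
        open ≡-Reasoning
        base≢0 : f base ≢ 0ℤ
        base≢0 = pos⇒≢0 base-pos
        fk≢0 : f k ≢ 0ℤ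
        fk≢0 eq = *-nonzero {+ 2} (λ ()) base≢0 (trans (sym fk≡2a) eq)
        negate : ∀ {j} → f j ≡ f base ⊎ f j ≡ - f base → L j ≡ L base → C j k ≢ 0ℤ →
                 ∃[ i ] f i ≡ f base × L i ≡ L base × C i k ≢ 0ℤ
        negate {j} (inj₁ eq) Lj≡l Cjk≢0 = j , eq , Lj≡l , Cjk≢0
        negate {j} (inj₂ eq) Lj≡l Cjk≢0 = s j j
          , trans (additive-neg f additive j) (trans (cong -_ eq) (ℤ.neg-involutive (f base)))
          , trans (L-s j j) Lj≡l
          , λ eq′ → Cjk≢0 (ℤ.neg-injective (trans (sym (row-neg j k)) eq′))
        double : ∀ x y → x * (+ 2 * y) ≡ (+ 2 * x) * y
        double = solve-∀
        one : ∀ i → f i ≡ f base → C k i ≢ 0ℤ → C k i ≡ 1ℤ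
        one i fi≡a Cki≢0 with reflected-value fk≢0 (λ eq → base≢0 (trans (sym fi≡a) eq)) Cki≢0
        ... | inj₁ eq = contradiction (ℕ.m*n≡1⇒m≡1 2 ℤ.∣ C k i ∣ (trans (sym (ℤ.abs-* (+ 2) (C k i))) (cong ℤ.∣_∣
                (ℤ.*-cancelʳ-≡ (+ 2 * C k i) 1ℤ (f base) {{ℤ.≢-nonZero base≢0}} (begin
                  + 2 * C k i * f base     ≡⟨ double (C k i) (f base) ⟨
                  C k i * (+ 2 * f base)   ≡⟨ cong (C k i *_) fk≡2a ⟨
                  C k i * f k              ≡⟨ trans eq fi≡a ⟩
                  f base                   ≡⟨ ℤ.*-identityˡ (f base) ⟨
                  1ℤ * f base              ∎))))) λ ()
        ... | inj₂ eq = ℤ.*-cancelʳ-≡ (C k i) 1ℤ (+ 2 * f base)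
                {{ℤ.≢-nonZero (*-nonzero {+ 2} (λ ()) base≢0)}} (begin
                  C k i * (+ 2 * f base)   ≡⟨ cong (C k i *_) fk≡2a ⟨
                  C k i * f k              ≡⟨ eq ⟩
                  + 2 * f i                ≡⟨ cong (+ 2 *_) fi≡a ⟩
                  + 2 * f base             ≡⟨ ℤ.*-identityˡ (+ 2 * f base) ⟨
                  1ℤ * (+ 2 * f base)      ∎)

-- The roots not orthogonal to the support of p are a union of components, and
-- q vanishes on all of them.
module _ {n} (Φ : CartanSystem n) where
  open CartanSystem Φ
  open Cartan Φ

  disjoint-supports : ∀ (p q : Fin n → ℤ) →
    Cartan.CorootAdditive dual p → Cartan.CorootAdditive dual q →
    (∀ j → p j * q j ≡ 0ℤ) → ∀ {i} → p i ≢ 0ℤ → ∀ j → q j ≡ 0ℤ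
  disjoint-supports p q p-additive q-additive p*q≡0 {i} pi≢0 j =
    decidable-stable (q j ℤ.≟ 0ℤ) λ qj≢0 →
      -- Where `p` is nonzero `q` vanishes, and vice versa. So at the reflection of `k` in `j` the
      -- value of `p` is p k and that of `q` is - C k j * q j, both nonzero.
      let (k , pk≢0 , Ckj≢0) = irreducible Q? orthogonal (i , pi≢0 , Cii≢0) j
          pj≡0 = off q p (λ a → trans (ℤ.*-comm (q a) (p a)) (p*q≡0 a)) qj≢0
          qk≡0 = off p q p*q≡0 pk≢0
      in *-nonzero (moved p p-additive pk≢0 pj≡0)
                   (λ eq → *-nonzero Ckj≢0 qj≢0 (negated eq qk≡0))
                   (p*q≡0 (s j k))
    where
    Cii≢0 : C i i ≢ 0ℤ
    Cii≢0 eq = contradiction (trans (sym (C-diag i)) eq) λ ()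
    Q : Fin n → Set
    Q j = ∃[ k ] p k ≢ 0ℤ × C k j ≢ 0ℤ
    Q? : ∀ j → Dec (Q j)
    Q? j = Fin.any? λ k → ¬? (p k ℤ.≟ 0ℤ) ×-dec ¬? (C k j ℤ.≟ 0ℤ)
    vanishes : ∀ {j} → ¬ Q j → ∀ k → p k ≢ 0ℤ → C k j ≡ 0ℤ
    vanishes {j} ¬Qj k pk≢0 = decidable-stable (C k j ℤ.≟ 0ℤ) λ Ckj≢0 → ¬Qj (k , pk≢0 , Ckj≢0)
    off : ∀ (f g : Fin n → ℤ) → (∀ a → f a * g a ≡ 0ℤ) → ∀ {a} → f a ≢ 0ℤ → g a ≡ 0ℤ
    off f g f*g≡0 {a} fa≢0 with ℤ.i*j≡0⇒i≡0∨j≡0 (f a) (f*g≡0 a)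
    ... | inj₁ eq = contradiction eq fa≢0
    ... | inj₂ eq = eq
    moved : ∀ f → Cartan.CorootAdditive dual f → ∀ {a b} → f a ≢ 0ℤ → f b ≡ 0ℤ → f (s b a) ≢ 0ℤ
    moved f f-additive {a} {b} fa≢0 fb≡0 eq = fa≢0 (begin
      f a                 ≡⟨ ℤ.+-identityʳ (f a) ⟨
      f a - 0ℤ            ≡⟨ cong (λ t → f a - t) (ℤ.*-zeroʳ (C a b)) ⟨
      f a - C a b * 0ℤ    ≡⟨ cong (λ t → f a - C a b * t) fb≡0 ⟨
      f a - C a b * f b   ≡⟨ f-additive b a ⟨
      f (s b a)           ≡⟨ eq ⟩
      0ℤ                  ∎)
      where open ≡-Reasoning
    negated : ∀ {k} → q (s j k) ≡ 0ℤ → q k ≡ 0ℤ → C k j * q j ≡ 0ℤ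
    negated {k} eq qk≡0 = trans (sym (ℤ.i-j≡0⇒i≡j (q k) _ (trans (sym (q-additive j k)) eq))) qk≡0
    -- `b` is orthogonal to the support of `p`. If `a` lies outside that support, then `k` and its
    -- reflection in `a` lie inside, and their pairings with `b` differ by C k a * C a b.
    orthogonal : ∀ {a b} → Q a → ¬ Q b → C a b ≡ 0ℤ
    orthogonal {a} {b} (k , pk≢0 , Cka≢0) ¬Qb with p a ℤ.≟ 0ℤ
    ... | no  pa≢0 = vanishes ¬Qb a pa≢0
    ... | yes pa≡0 = [ (λ eq → contradiction eq Cka≢0) , id ]′ (ℤ.i*j≡0⇒i≡0∨j≡0 (C k a)
            (trans (sym (ℤ.i-j≡0⇒i≡j (C k b) _
              (trans (sym (C-sˡ a k b)) (vanishes ¬Qb (s a k) (moved p p-additive pk≢0 pa≡0)))))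
              (vanishes ¬Qb k pk≢0)))

-- Root data

module _ {n q} {Q : Fin n → Set q} (Q? : ∀ i → Dec (Q i)) where

  comprehension : Subset n
  comprehension = tabulate (does ∘ Q?)

  ∈-comprehension⁺ : ∀ {i} → Q i → i ∈ comprehension
  ∈-comprehension⁺ {i} q = lookup⇒[]= i comprehension (trans (lookup∘tabulate (does ∘ Q?) i) (dec-true (Q? i) q))

  ∈-comprehension⁻ : ∀ {i} → i ∈ comprehension → Q i
  ∈-comprehension⁻ {i} i∈ with Q? i | trans (sym (lookup∘tabulate (does ∘ Q?) i)) ([]=⇒lookup i∈)
  ... | yes q | _ = q

module Functional {c ℓ} (M : ℤ-Module c ℓ) {f : ∣ M ∣ → ℤ} (F : IsFunctional M f) where
  open LeftModule M
  open LeftModuleMorphisms.IsLeftModuleHomomorphism F public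
    using (⟦⟧-cong; +ᴹ-homo; 0ᴹ-homo; -ᴹ-homo)
  open LeftModuleMorphisms.IsLeftModuleHomomorphism F using (*ₗ-homo)

  scalar-homo : ∀ a x → f (a *ₗ x) ≡ a * f x
  scalar-homo = *ₗ-homo

  combination-homo : ∀ {n} (v : Fin n → ∣ M ∣) (a : Fin n → ℤ) →
                     f (combination M v a) ≡ sum (λ i → a i * f (v i))
  combination-homo {ℕ.zero}  v a = 0ᴹ-homo
  combination-homo {ℕ.suc n} v a = trans (+ᴹ-homo (a zero *ₗ v zero) _)
    (cong₂ _+_ (*ₗ-homo (a zero) (v zero)) (combination-homo (v ∘ suc) (a ∘ suc)))

  difference-homo : ∀ x a y → f (x +ᴹ -ᴹ (a *ₗ y)) ≡ f x - a * f y
  difference-homo x a y = trans (+ᴹ-homo x _)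
    (cong (λ u → f x + u) (trans (-ᴹ-homo _) (cong -_ (*ₗ-homo a y))))

module Datum {c ℓ} (R : RootDatum c ℓ) where
  open RootDatum R

  C : Fin #Φ → Fin #Φ → ℤ
  C i j = ⟨ root i , coroot j ⟩

  -- The axioms permute roots and coroots separately; `s≡t` below identifies the two permutations of
  -- the indices.
  s t : Fin #Φ → Fin #Φ → Fin #Φ
  s i j = proj₁ (reflection-root i j)
  t i j = proj₁ (coreflection-coroot i j)

  ⟨⟩-congˡ : ∀ {x x′} y → x X.≈ᴹ x′ → ⟨ x , y ⟩ ≡ ⟨ x′ , y ⟩
  ⟨⟩-congˡ y = Functional.⟦⟧-cong X (linearˡ y)

  ⟨⟩-congʳ : ∀ x {y y′} → y Y.≈ᴹ y′ → ⟨ x , y ⟩ ≡ ⟨ x , y′ ⟩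
  ⟨⟩-congʳ x = Functional.⟦⟧-cong Y (linearʳ x)

  pair-reflection : ∀ i x y → ⟨ reflection i x , y ⟩ ≡ ⟨ x , y ⟩ - ⟨ x , coroot i ⟩ * ⟨ root i , y ⟩
  pair-reflection i x y = Functional.difference-homo X (linearˡ y) x _ (root i)

  pair-coreflection : ∀ i x y → ⟨ x , coreflection i y ⟩ ≡ ⟨ x , y ⟩ - ⟨ root i , y ⟩ * ⟨ x , coroot i ⟩
  pair-coreflection i x y = Functional.difference-homo Y (linearʳ x) y _ (coroot i)

  pair-s : ∀ i j y → ⟨ root (s i j) , y ⟩ ≡ ⟨ root j , y ⟩ - C j i * ⟨ root i , y ⟩
  pair-s i j y = trans (sym (⟨⟩-congˡ y (proj₂ (reflection-root i j)))) (pair-reflection i (root j) y)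

  pair-t : ∀ i j x → ⟨ x , coroot (t i j) ⟩ ≡ ⟨ x , coroot j ⟩ - C i j * ⟨ x , coroot i ⟩
  pair-t i j x = trans (sym (⟨⟩-congʳ x (proj₂ (coreflection-coroot i j)))) (pair-coreflection i x (coroot j))

  double-reflection : ∀ {x w v} y z → w ≡ + 2 → v ≡ x - y * z → v - (y - y * w) * z ≡ x
  double-reflection {x} y z refl refl = identity x y z
    where
    identity : ∀ x y z → (x - y * z) - (y - y * + 2) * z ≡ x
    identity = solve-∀

  s-involutive : ∀ i j → s i (s i j) ≡ j
  s-involutive i j = root-injective (separatesʳ λ y → begin
    ⟨ root (s i (s i j)) , y ⟩                                  ≡⟨ pair-s i (s i j) y ⟩
    ⟨ root (s i j) , y ⟩ - C (s i j) i * ⟨ root i , y ⟩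
      ≡⟨ cong (λ u → ⟨ root (s i j) , y ⟩ - u * ⟨ root i , y ⟩) (pair-s i j (coroot i)) ⟩
    ⟨ root (s i j) , y ⟩ - (C j i - C j i * C i i) * ⟨ root i , y ⟩
      ≡⟨ double-reflection (C j i) ⟨ root i , y ⟩ (root-coroot-2 i) (pair-s i j y) ⟩
    ⟨ root j , y ⟩ ∎)
    where open ≡-Reasoning

  t-involutive : ∀ i j → t i (t i j) ≡ j
  t-involutive i j = coroot-injective (separatesˡ λ x → begin
    ⟨ x , coroot (t i (t i j)) ⟩                                  ≡⟨ pair-t i (t i j) x ⟩
    ⟨ x , coroot (t i j) ⟩ - C i (t i j) * ⟨ x , coroot i ⟩
      ≡⟨ cong (λ u → ⟨ x , coroot (t i j) ⟩ - u * ⟨ x , coroot i ⟩) (pair-t i j (root i)) ⟩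
    ⟨ x , coroot (t i j) ⟩ - (C i j - C i j * C i i) * ⟨ x , coroot i ⟩
      ≡⟨ double-reflection (C i j) ⟨ x , coroot i ⟩ (root-coroot-2 i) (pair-t i j x) ⟩
    ⟨ x , coroot j ⟩ ∎)
    where open ≡-Reasoning

  -- Squared lengths of roots and of coroots. They are needed before a Cartan system exists, since
  -- `s≡t` and `proportional`, from which it is built, rely on them.
  L L′ : Fin #Φ → ℤ
  L  m = sum (λ k → C m k * C m k)
  L′ m = sum (λ k → C k m * C k m)

  negated : ∀ {x y} → y ≡ + 2 → x - x * y ≡ - x
  negated {x} refl = identity x
    where
    identity : ∀ x → x - x * + 2 ≡ - x
    identity = solve-∀

  negated′ : ∀ {x y} → y ≡ + 2 → x - y * x ≡ - x
  negated′ {x} {y} eq = trans (cong (λ z → x - z) (ℤ.*-comm y x)) (negated eq)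

  2*pairing-coroots : ∀ x m → + 2 * sum (λ k → ⟨ x , coroot k ⟩ * C m k) ≡ ⟨ x , coroot m ⟩ * L m
  2*pairing-coroots x m = 2*sum≡ {f = λ k → ⟨ x , coroot k ⟩} {C m} {⟨ x , coroot m ⟩} (t-involutive m)
    (λ k → trans (pair-t m k (root m)) (negated (root-coroot-2 m)))
    (λ k → pair-t m k x)

  2*pairing-roots : ∀ y m → + 2 * sum (λ k → ⟨ root k , y ⟩ * C k m) ≡ ⟨ root m , y ⟩ * L′ m
  2*pairing-roots y m = 2*sum≡ {f = λ k → ⟨ root k , y ⟩} {λ k → C k m} {⟨ root m , y ⟩} (s-involutive m)
    (λ k → trans (pair-s m k (coroot m)) (negated (root-coroot-2 m)))
    (λ k → pair-s m k y)

  C-s≡C-t : ∀ i j k → C (s i j) k ≡ C j (t i k)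
  C-s≡C-t i j k = trans (pair-s i j (coroot k))
    (trans (cong (λ u → C j k - u) (ℤ.*-comm (C j i) (C i k))) (sym (pair-t i k (root j))))

  L-s : ∀ i j → L (s i j) ≡ L j
  L-s i j = trans (sum-cong-≗ (λ k → cong₂ _*_ (C-s≡C-t i j k) (C-s≡C-t i j k)))
                  (sym (sum-reindex (λ k → C j k * C j k) (t-involutive i)))

  norm-pos : ∀ {n} (f : Fin n → ℤ) i → f i ≡ + 2 → 0ℤ < sum (λ k → f k * f k)
  norm-pos f i fi≡2 = ℤ.<-≤-trans (ℤ.+<+ (s≤s z≤n))
    (subst (λ c → c * c ≤ sum (λ k → f k * f k)) fi≡2 (term≤sum (λ k → square-nonneg (f k)) i))

  -- The bijection between roots and coroots is equivariant: the coroot of α is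
  -- 2 (α , -) / (α , α) for the invariant form (x , y) = Σ_β ⟨ x , β^∨ ⟩ ⟨ y , β^∨ ⟩.
  s≡t : ∀ i j → s i j ≡ t i j
  s≡t i j = coroot-injective (separatesˡ λ x →
    ℤ.*-cancelʳ-≡ _ _ (L (s i j)) {{ℤ.≢-nonZero (pos⇒≢0 (norm-pos (C (s i j)) (s i j) (root-coroot-2 (s i j))))}} (begin
      ⟨ x , coroot (s i j) ⟩ * L (s i j)
        ≡⟨ 2*pairing-coroots x (s i j) ⟨
      + 2 * sum (λ k → ⟨ x , coroot k ⟩ * C (s i j) k)
        ≡⟨ cong (+ 2 *_) (sum-reindex (λ k → ⟨ x , coroot k ⟩ * C (s i j) k) (t-involutive i)) ⟩
      + 2 * sum (λ k → ⟨ x , coroot (t i k) ⟩ * C (s i j) (t i k))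
        ≡⟨ cong (+ 2 *_) (sum-cong-≗ (λ k → cong₂ _*_ (reflected x k)
             (trans (C-s≡C-t i j (t i k)) (cong (C j) (t-involutive i k))))) ⟩
      + 2 * sum (λ k → ⟨ reflection i x , coroot k ⟩ * C j k)
        ≡⟨ 2*pairing-coroots (reflection i x) j ⟩
      ⟨ reflection i x , coroot j ⟩ * L j
        ≡⟨ cong₂ _*_ (sym (reflected x j)) (sym (L-s i j)) ⟩
      ⟨ x , coroot (t i j) ⟩ * L (s i j) ∎))
    where
    open ≡-Reasoning
    reflected : ∀ x k → ⟨ x , coroot (t i k) ⟩ ≡ ⟨ reflection i x , coroot k ⟩
    reflected x k = trans (pair-t i k x)
      (trans (cong (λ u → ⟨ x , coroot k ⟩ - u) (ℤ.*-comm (C i k) ⟨ x , coroot i ⟩)) (sym (pair-reflection i x (coroot k))))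

  pair-s-coroot : ∀ i j x → ⟨ x , coroot (s i j) ⟩ ≡ ⟨ x , coroot j ⟩ - C i j * ⟨ x , coroot i ⟩
  pair-s-coroot i j x = trans (cong (λ k → ⟨ x , coroot k ⟩) (s≡t i j)) (pair-t i j x)

module Simple {c ℓ} (R : RootDatum c ℓ) (simple : IsSimple R) where
  open RootDatum R
  open IsSimple simple
  open Datum R

  root-sᵢᵢ : ∀ i y → ⟨ root (s i i) , y ⟩ ≡ - ⟨ root i , y ⟩
  root-sᵢᵢ i y = trans (pair-s i i y) (negated′ (root-coroot-2 i))

  -- Equality in the Cauchy-Schwarz inequality: the norm of 2 α_i^∨ - C j i α_j^∨ is zero, so this
  -- combination vanishes on all roots. Summing against the roots carries the relation over to α_i
  -- and α_j with the factors 2 L′ i and C j i * L′ j, and reducedness applies.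
  proportional : ∀ {i j} → C i j * C j i ≡ + 4 → j ≡ i ⊎ j ≡ s i i
  proportional {i} {j} nn′≡4 = Sum.map root-injective
    (λ eq → root-injective (X.≈ᴹ-trans eq (separatesʳ λ y →
      trans (Functional.-ᴹ-homo X (linearˡ y) (root i)) (sym (root-sᵢᵢ i y)))))
    (reduced i j (+ 2 * L′ i) (C j i * L′ j) (*-nonzero Cji≢0 (L′≢0 j)) multiples)
    where
    open ≡-Reasoning
    L′≢0 : ∀ k → L′ k ≢ 0ℤ
    L′≢0 k = pos⇒≢0 (norm-pos (λ l → C l k) k (root-coroot-2 k))
    Cji≢0 : C j i ≢ 0ℤ
    Cji≢0 eq = contradiction (trans (sym nn′≡4) (trans (cong (C i j *_) eq) (ℤ.*-zeroʳ (C i j)))) λ ()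
    difference-norm : sum (λ k → (+ 2 * C k i - C j i * C k j) * (+ 2 * C k i - C j i * C k j)) ≡ 0ℤ
    difference-norm = begin
      sum (λ k → (+ 2 * C k i - C j i * C k j) * (+ 2 * C k i - C j i * C k j))
        ≡⟨ norm-difference (λ k → C k i) (λ k → C k j) (C j i) (C i j)
             (2*pairing-roots (coroot i) j)
             (trans (cong (+ 2 *_) (sum-cong-≗ (λ k → ℤ.*-comm (C k i) (C k j)))) (2*pairing-roots (coroot j) i)) ⟩
      (+ 4 - C j i * C i j) * L′ i   ≡⟨ cong (λ u → (+ 4 - u) * L′ i) (trans (ℤ.*-comm (C j i) (C i j)) nn′≡4) ⟩
      0ℤ                             ∎
    coroots : ∀ k → + 2 * C k i ≡ C j i * C k j
    coroots k = ℤ.i-j≡0⇒i≡j (+ 2 * C k i) _ (square-zero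
      (nonneg-sum-zero (λ k → square-nonneg (+ 2 * C k i - C j i * C k j)) (ℤ.≤-reflexive difference-norm) k))
    shuffle₁ : ∀ l r → + 2 * l * r ≡ + 2 * (r * l)
    shuffle₁ = solve-∀
    shuffle₂ : ∀ a b → + 2 * (a * b) ≡ a * (+ 2 * b)
    shuffle₂ = solve-∀
    shuffle₃ : ∀ a b c → a * (b * c) ≡ a * c * b
    shuffle₃ = solve-∀
    shuffle₄ : ∀ a b c → a * (b * c) ≡ b * (a * c)
    shuffle₄ = solve-∀
    scaled : ∀ y → + 2 * L′ i * ⟨ root i , y ⟩ ≡ C j i * L′ j * ⟨ root j , y ⟩
    scaled y = begin
      + 2 * L′ i * r i                             ≡⟨ shuffle₁ (L′ i) (r i) ⟩
      + 2 * (r i * L′ i)                           ≡⟨ cong (+ 2 *_) (2*pairing-roots y i) ⟨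
      + 2 * (+ 2 * sum (λ k → r k * C k i))        ≡⟨ cong (+ 2 *_) (*-distribˡ-sum (+ 2) (λ k → r k * C k i)) ⟩
      + 2 * sum (λ k → + 2 * (r k * C k i))        ≡⟨ cong (+ 2 *_) (sum-cong-≗ λ k → trans (shuffle₂ (r k) (C k i))
                                                      (trans (cong (r k *_) (coroots k)) (shuffle₄ (r k) (C j i) (C k j)))) ⟩
      + 2 * sum (λ k → C j i * (r k * C k j))      ≡⟨ cong (+ 2 *_) (*-distribˡ-sum (C j i) (λ k → r k * C k j)) ⟨
      + 2 * (C j i * sum (λ k → r k * C k j))      ≡⟨ shuffle₂ (C j i) _ ⟩
      C j i * (+ 2 * sum (λ k → r k * C k j))      ≡⟨ cong (C j i *_) (2*pairing-roots y j) ⟩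
      C j i * (r j * L′ j)                         ≡⟨ shuffle₃ (C j i) (r j) (L′ j) ⟩
      C j i * L′ j * r j                           ∎
      where
      r : Fin #Φ → ℤ
      r k = ⟨ root k , y ⟩
    multiples : (+ 2 * L′ i) X.*ₗ root i X.≈ᴹ (C j i * L′ j) X.*ₗ root j
    multiples = separatesʳ λ y → trans (Functional.scalar-homo X (linearˡ y) (+ 2 * L′ i) (root i))
      (trans (scaled y) (sym (Functional.scalar-homo X (linearˡ y) (C j i * L′ j) (root j))))

  connected : ∀ {Q : Fin #Φ → Set} → (∀ i → Dec (Q i)) →
              (∀ {i j} → Q i → ¬ Q j → C i j ≡ 0ℤ) → ∀ {i} → Q i → ∀ j → Q j
  connected Q? orthogonal {i} Qi j with proj₂ irreducible (comprehension Q?)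
    (λ i∈ j∉ → orthogonal (∈-comprehension⁻ Q? i∈) (j∉ ∘ ∈-comprehension⁺ Q?))
  ... | inj₁ empty = contradiction (i , ∈-comprehension⁺ Q? Qi) empty
  ... | inj₂ empty = decidable-stable (Q? j) λ ¬Qj →
          empty (j , x∉p⇒x∈∁p (¬Qj ∘ ∈-comprehension⁻ Q?))

  system : CartanSystem #Φ
  system = record
    { C            = C
    ; s            = s
    ; C-diag       = root-coroot-2
    ; C-sˡ         = λ i j k → pair-s i j (coroot k)
    ; C-sʳ         = λ i j k → pair-s-coroot i j (root k)
    ; s-involutive = s-involutive
    ; reduced      = proportional
    ; irreducible  = connected
    }

-- Chambers and bases

module Bases {c ℓ} (R : RootDatum c ℓ) (isSimple : IsSimple R) where
  open RootDatum R
  open Datum R using (C; s; ⟨⟩-congˡ)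
  open Simple R isSimple using (root-sᵢᵢ)


  -- Equality in `X` and quantification over `Y` carry no decision procedure of their own; the
  -- coordinates in a finite basis of `X` do.
  vanishes? : ∀ x → Dec (∀ y → ⟨ x , y ⟩ ≡ 0ℤ)
  vanishes? x with (e , spans , independent) ← X-free with (a , x≈) ← spans x = map′ to from (Fin.all? (λ i → a i ℤ.≟ 0ℤ))
    where
    evaluate : ∀ y → ⟨ x , y ⟩ ≡ sum (λ i → a i * ⟨ e i , y ⟩)
    evaluate y = trans (⟨⟩-congˡ y x≈) (Functional.combination-homo X (linearˡ y) e a)
    to : (∀ i → a i ≡ 0ℤ) → ∀ y → ⟨ x , y ⟩ ≡ 0ℤ
    to a≡0 y = trans (evaluate y) (sum-zero λ i → cong (_* ⟨ e i , y ⟩) (a≡0 i))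
    from : (∀ y → ⟨ x , y ⟩ ≡ 0ℤ) → ∀ i → a i ≡ 0ℤ
    from x≡0 = independent a (X.≈ᴹ-trans (X.≈ᴹ-sym x≈) (separatesʳ λ y →
      trans (x≡0 y) (sym (Functional.0ᴹ-homo X (linearˡ y)))))

  infix 4 _≐_⊕_

  _≐_⊕_ : Fin #Φ → Fin #Φ → Fin #Φ → Set c
  i ≐ j ⊕ k = ∀ y → ⟨ root i , y ⟩ ≡ ⟨ root j , y ⟩ + ⟨ root k , y ⟩

  ≐⊕? : ∀ i j k → Dec (i ≐ j ⊕ k)
  ≐⊕? i j k = map′ (λ x≡0 y → ℤ.i-j≡0⇒i≡j ⟨ root i , y ⟩ _ (trans (sym (evaluate y)) (x≡0 y)))
                   (λ i≐j⊕k y → trans (evaluate y) (ℤ.i≡j⇒i-j≡0 (i≐j⊕k y)))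
                   (vanishes? (root i X.+ᴹ X.-ᴹ (1ℤ X.*ₗ (root j X.+ᴹ root k))))
    where
    evaluate : ∀ y → ⟨ root i X.+ᴹ X.-ᴹ (1ℤ X.*ₗ (root j X.+ᴹ root k)) , y ⟩
                   ≡ ⟨ root i , y ⟩ - (⟨ root j , y ⟩ + ⟨ root k , y ⟩)
    evaluate y = trans (Functional.difference-homo X (linearˡ y) (root i) 1ℤ _)
      (cong (λ u → ⟨ root i , y ⟩ - u) (trans (ℤ.*-identityˡ _) (Functional.+ᴹ-homo X (linearˡ y) (root j) (root k))))

  -- Combinations of coroots have this property. It turns the vanishing norm of a combination of
  -- roots into vanishing height.
  Radical : ∣ Y ∣ → Set c
  Radical y = ∀ x → (∀ k → ⟨ x , coroot k ⟩ ≡ 0ℤ) → ⟨ x , y ⟩ ≡ 0ℤ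

  Regular : ∣ Y ∣ → Set
  Regular y = ∀ i → ⟨ root i , y ⟩ ≢ 0ℤ

  infix 4 _≽_

  -- When `y′` is regular, this says that `y` lies in the closure of the chamber of `y′`.
  _≽_ : ∣ Y ∣ → ∣ Y ∣ → Set
  y′ ≽ y = ∀ i → 0ℤ < ⟨ root i , y ⟩ → 0ℤ < ⟨ root i , y′ ⟩

  ≽⇒≢0 : ∀ {y y′} → y′ ≽ y → ∀ i → ⟨ root i , y ⟩ ≢ 0ℤ → ⟨ root i , y′ ⟩ ≢ 0ℤ
  ≽⇒≢0 {y} {y′} refines i ≢0 with ℤ.<-cmp 0ℤ ⟨ root i , y ⟩
  ... | tri< pos _ _ = pos⇒≢0 (refines i pos)
  ... | tri≈ _ 0≡ _  = contradiction (sym 0≡) ≢0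
  ... | tri> _ _ neg = λ eq → pos⇒≢0 (refines (s i i) (subst (0ℤ <_) (sym (root-sᵢᵢ i y)) (ℤ.neg-mono-< neg)))
                                     (trans (root-sᵢᵢ i y′) (cong -_ eq))

  -- A large multiple of `y` plus the coroot `j`: the multiple dominates wherever a root is positive
  -- on `y`, and if root `j` vanishes on `y` the coroot contributes 2.
  perturb : ∀ y j → Radical y → ∃[ y′ ] Radical y′ × y′ ≽ y × ⟨ root j , y′ ⟩ ≢ 0ℤ
  perturb y j radical = y′ , radical′ , refines , nonzero
    where
    -- N outweighs all pairings of roots with the coroot j.
    S N : ℤ
    S = sum (λ i → + ℤ.∣ C i j ∣)
    N = 1ℤ + S
    0≤∣C∣ : ∀ i → 0ℤ ≤ + ℤ.∣ C i j ∣
    0≤∣C∣ i = ℤ.+≤+ z≤n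
    S<N : S < N
    S<N = subst (_< N) (ℤ.+-identityˡ S) (ℤ.+-monoˡ-< S (ℤ.+<+ (s≤s z≤n)))
    0<N : 0ℤ < N
    0<N = ℤ.≤-<-trans (sum-nonneg 0≤∣C∣) S<N
    bound : ∀ i → - C i j < N
    bound i = ℤ.≤-<-trans (i≤∣i∣ (- C i j))
      (subst (λ u → + u < N) (sym (ℤ.∣-i∣≡∣i∣ (C i j))) (ℤ.≤-<-trans (term≤sum 0≤∣C∣ i) S<N))
    y′ : ∣ Y ∣
    y′ = (N Y.*ₗ y) Y.+ᴹ coroot j
    evaluate : ∀ x → ⟨ x , y′ ⟩ ≡ N * ⟨ x , y ⟩ + ⟨ x , coroot j ⟩
    evaluate x = trans (Functional.+ᴹ-homo Y (linearʳ x) _ (coroot j))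
      (cong (_+ ⟨ x , coroot j ⟩) (Functional.scalar-homo Y (linearʳ x) N y))
    radical′ : Radical y′
    radical′ x x⊥ = trans (evaluate x)
      (trans (cong₂ _+_ (trans (cong (N *_) (radical x x⊥)) (ℤ.*-zeroʳ N)) (x⊥ j)) refl)
    refines : y′ ≽ y
    refines i 0<u = subst (0ℤ <_) (sym (evaluate (root i)))
      (subst (_< N * u + C i j) (ℤ.+-inverseˡ (C i j)) (ℤ.+-monoˡ-< (C i j) (ℤ.<-≤-trans (bound i)
        (subst (_≤ N * u) (ℤ.*-identityʳ N) (ℤ.*-monoˡ-≤-nonNeg N {{ℤ.nonNegative (ℤ.<⇒≤ 0<N)}} (ℤ.i<j⇒suc[i]≤j 0<u))))))
      where
      u = ⟨ root i , y ⟩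
    nonzero : ⟨ root j , y′ ⟩ ≢ 0ℤ
    nonzero with ⟨ root j , y ⟩ ℤ.≟ 0ℤ
    ... | no  ≢0 = ≽⇒≢0 refines j ≢0
    ... | yes ≡0 = λ eq → contradiction (trans (sym eq) (trans (evaluate (root j))
            (cong₂ _+_ (trans (cong (N *_) ≡0) (ℤ.*-zeroʳ N)) (root-coroot-2 j)))) λ ()

  -- One perturbation per root suffices, because refinement never brings a nonzero value back to
  -- zero.
  regularize : ∀ y → Radical y → ∃[ y′ ] Radical y′ × y′ ≽ y × Regular y′
  regularize y radical with go (allFin #Φ)
    where
    go : ∀ js → ∃[ y′ ] Radical y′ × y′ ≽ y × All (λ j → ⟨ root j , y′ ⟩ ≢ 0ℤ) js
    go [] = y , radical , (λ _ → id) , []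
    go (j ∷ js) with (y′ , radical′ , refines′ , nonzero′) ← go js
                with (y″ , radical″ , refines″ , nonzero″) ← perturb y′ j radical′ =
      y″ , radical″ , (λ i → refines″ i ∘ refines′ i)
      , nonzero″ ∷ All.map (λ {i} → ≽⇒≢0 refines″ i) nonzero′
  ... | (y′ , radical′ , refines′ , nonzero′) = y′ , radical′ , refines′ , λ i → All.lookup nonzero′ (∈-allFin i)

-- The indecomposable roots of a chamber

module Chamber {c ℓ} (R : RootDatum c ℓ) (isSimple : IsSimple R) where
  open RootDatum R
  open Datum R using (C; s; pair-s; ⟨⟩-congˡ)
  open Simple R isSimple using (system; root-sᵢᵢ)
  open Cartan system using (L; acute⇒1; form; 2*form; L-pos)
  open Bases R isSimple

  module _ (y : ∣ Y ∣) (radical : Radical y) (regular : Regular y) where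

    Pos : Fin #Φ → Set
    Pos i = 0ℤ < ⟨ root i , y ⟩

    pos? : ∀ i → Dec (Pos i)
    pos? i = 0ℤ ℤ.<? ⟨ root i , y ⟩

    ¬pos⇒pos-s : ∀ {i} → ¬ Pos i → Pos (s i i)
    ¬pos⇒pos-s {i} ¬pos with ℤ.<-cmp 0ℤ ⟨ root i , y ⟩
    ... | tri< pos _ _ = contradiction pos ¬pos
    ... | tri≈ _ 0≡ _  = contradiction (sym 0≡) (regular i)
    ... | tri> _ _ neg = subst (0ℤ <_) (sym (root-sᵢᵢ i y)) (ℤ.neg-mono-< neg)

    Decomposable : Fin #Φ → Set c
    Decomposable i = ∃[ j ] ∃[ k ] Pos j × Pos k × i ≐ j ⊕ k

    decomposable? : ∀ i → Dec (Decomposable i)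
    decomposable? i = Fin.any? λ j → Fin.any? λ k → pos? j ×-dec pos? k ×-dec ≐⊕? i j k

    Indecomposable : Fin #Φ → Set c
    Indecomposable i = Pos i × ¬ Decomposable i

    indecomposable? : ∀ i → Dec (Indecomposable i)
    indecomposable? i = pos? i ×-dec ¬? (decomposable? i)

    Δ : Subset #Φ
    Δ = comprehension indecomposable?

    ∈Δ⇒pos : ∀ {i} → i ∈ Δ → Pos i
    ∈Δ⇒pos = proj₁ ∘ ∈-comprehension⁻ indecomposable?

    ∈Δ⇒indecomposable : ∀ {i} → i ∈ Δ → ¬ Decomposable i
    ∈Δ⇒indecomposable = proj₂ ∘ ∈-comprehension⁻ indecomposable?

    heights-decrease : ∀ {i j k} → Pos j → Pos k → i ≐ j ⊕ k →
      ℤ.∣ ⟨ root j , y ⟩ ∣ ℕ.< ℤ.∣ ⟨ root i , y ⟩ ∣ × ℤ.∣ ⟨ root k , y ⟩ ∣ ℕ.< ℤ.∣ ⟨ root i , y ⟩ ∣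
    heights-decrease {i} {j} {k} posⱼ posₖ i≐j⊕k rewrite i≐j⊕k y =
      ∣i∣<∣i+j∣ posⱼ posₖ , subst (λ u → ℤ.∣ ⟨ root k , y ⟩ ∣ ℕ.< ℤ.∣ u ∣)
                                 (ℤ.+-comm ⟨ root k , y ⟩ ⟨ root j , y ⟩) (∣i∣<∣i+j∣ posₖ posⱼ)

    Expansion : Fin #Φ → Set c
    Expansion i = ∃[ a ] SupportedOn Δ a × (∀ j → 0ℤ ≤ a j) ×
                  (∀ z → ⟨ root i , z ⟩ ≡ sum (λ j → a j * ⟨ root j , z ⟩))

    -- Induction on the height ⟨α , y⟩, which drops for both summands of a decomposition; `m` is a
    -- strict bound on it that makes the recursion structural.
    expand : ∀ m i → Pos i → ℤ.∣ ⟨ root i , y ⟩ ∣ ℕ.< m → Expansion i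
    expand (ℕ.suc m) i pos (s≤s h<m) with decomposable? i
    ... | yes (j , k , posⱼ , posₖ , i≐j⊕k)
        with (a , a-supp , 0≤a , j≡a) ← expand m j posⱼ (ℕ.<-≤-trans (proj₁ (heights-decrease posⱼ posₖ i≐j⊕k)) h<m)
           | (b , b-supp , 0≤b , k≡b) ← expand m k posₖ (ℕ.<-≤-trans (proj₂ (heights-decrease posⱼ posₖ i≐j⊕k)) h<m) =
          (λ l → a l + b l)
          , (λ l∉Δ → cong₂ _+_ (a-supp l∉Δ) (b-supp l∉Δ))
          , (λ l → ℤ.+-mono-≤ (0≤a l) (0≤b l))
          , λ z → begin
              ⟨ root i , z ⟩                                   ≡⟨ i≐j⊕k z ⟩
              ⟨ root j , z ⟩ + ⟨ root k , z ⟩                  ≡⟨ cong₂ _+_ (j≡a z) (k≡b z) ⟩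
              sum (λ l → a l * ⟨ root l , z ⟩) + sum (λ l → b l * ⟨ root l , z ⟩)
                ≡⟨ ∑-distrib-+ (λ l → a l * ⟨ root l , z ⟩) (λ l → b l * ⟨ root l , z ⟩) ⟨
              sum (λ l → a l * ⟨ root l , z ⟩ + b l * ⟨ root l , z ⟩)
                ≡⟨ sum-cong-≗ (λ l → ℤ.*-distribʳ-+ (⟨_,_⟩ (root l) z) (a l) (b l)) ⟨
              sum (λ l → (a l + b l) * ⟨ root l , z ⟩)         ∎
      where
      open ≡-Reasoning
    ... | no ¬dec = unit , supported , nonneg , λ z → sym (sum-unit i (λ j → ⟨ root j , z ⟩))
      where
      unit : Fin #Φ → ℤ
      unit j = if does (i Fin.≟ j) then 1ℤ else 0ℤ
      supported : SupportedOn Δ unit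
      supported {j} j∉Δ with i Fin.≟ j
      ... | yes refl = contradiction (∈-comprehension⁺ indecomposable? (pos , ¬dec)) j∉Δ
      ... | no _     = refl
      nonneg : ∀ j → 0ℤ ≤ unit j
      nonneg j with does (i Fin.≟ j)
      ... | true  = ℤ.+≤+ z≤n
      ... | false = ℤ.≤-refl

    same-sign : ∀ i → ∃[ a ] SupportedOn Δ a × root i X.≈ᴹ combination X root a ×
                ((∀ j → 0ℤ ≤ a j) ⊎ (∀ j → a j ≤ 0ℤ))
    same-sign i with pos? i
    ... | yes pos with (a , supp , 0≤a , i≡a) ← expand _ i pos (ℕ.n<1+n _) =
            a , supp
            , separatesʳ (λ z → trans (i≡a z) (sym (Functional.combination-homo X (linearˡ z) root a)))
            , inj₁ 0≤a
    ... | no ¬pos with (a , supp , 0≤a , i≡a) ← expand _ (s i i) (¬pos⇒pos-s ¬pos) (ℕ.n<1+n _) =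
            (λ j → - a j) , (λ j∉Δ → cong -_ (supp j∉Δ))
            , separatesʳ (λ z → begin
                ⟨ root i , z ⟩                                 ≡⟨ ℤ.neg-involutive (⟨_,_⟩ (root i) z) ⟨
                - - ⟨ root i , z ⟩                             ≡⟨ cong -_ (root-sᵢᵢ i z) ⟨
                - ⟨ root (s i i) , z ⟩                         ≡⟨ cong -_ (i≡a z) ⟩
                - sum (λ j → a j * ⟨ root j , z ⟩)             ≡⟨ ℤ.-1*i≡-i (sum (λ j → a j * ⟨_,_⟩ (root j) z)) ⟨
                -1ℤ * sum (λ j → a j * ⟨ root j , z ⟩)         ≡⟨ *-distribˡ-sum -1ℤ (λ j → a j * ⟨ root j , z ⟩) ⟩
                sum (λ j → -1ℤ * (a j * ⟨ root j , z ⟩))       ≡⟨ sum-cong-≗ (λ j → shuffle (a j) ⟨ root j , z ⟩) ⟩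
                sum (λ j → - a j * ⟨ root j , z ⟩)
                  ≡⟨ Functional.combination-homo X (linearˡ z) root (λ j → - a j) ⟨
                ⟨ combination X root (λ j → - a j) , z ⟩       ∎)
            , inj₂ (λ j → ℤ.neg-mono-≤ (0≤a j))
      where
      open ≡-Reasoning
      shuffle : ∀ x u → -1ℤ * (x * u) ≡ - x * u
      shuffle = solve-∀

    -- Were the difference a positive root, it would decompose α_i; were it negative, its opposite
    -- would decompose α_j.
    no-difference : ∀ {i j} → i ∈ Δ → j ∈ Δ → ∀ k → ¬ (∀ z → ⟨ root k , z ⟩ ≡ ⟨ root i , z ⟩ - ⟨ root j , z ⟩)
    no-difference {i} {j} i∈Δ j∈Δ k k≡i-j with pos? k
    ... | yes pos = ∈Δ⇒indecomposable i∈Δ (k , j , pos , ∈Δ⇒pos j∈Δ , λ z →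
            trans (sym (identity ⟨ root i , z ⟩ ⟨ root j , z ⟩)) (cong (_+ ⟨ root j , z ⟩) (sym (k≡i-j z))))
      where
      identity : ∀ x u → (x - u) + u ≡ x
      identity = solve-∀
    ... | no ¬pos = ∈Δ⇒indecomposable j∈Δ (s k k , i , ¬pos⇒pos-s ¬pos , ∈Δ⇒pos i∈Δ , λ z →
            trans (sym (identity ⟨ root i , z ⟩ ⟨ root j , z ⟩))
              (cong (_+ ⟨ root i , z ⟩) (sym (trans (root-sᵢᵢ k z) (cong -_ (k≡i-j z))))))
      where
      identity : ∀ x u → - (x - u) + x ≡ u
      identity = solve-∀

    -- At an acute angle one of the Cartan integers is 1, and the corresponding reflection produces
    -- the difference of two indecomposable roots.
    obtuse : ∀ {i j} → i ∈ Δ → j ∈ Δ → i ≢ j → C i j ≤ 0ℤ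
    obtuse {i} {j} i∈Δ j∈Δ i≢j = ℤ.≮⇒≥ λ 0<Cij → case acute⇒1 0<Cij i≢j of λ
      { (inj₁ Cij≡1) → no-difference i∈Δ j∈Δ (s j i) (difference Cij≡1)
      ; (inj₂ Cji≡1) → no-difference j∈Δ i∈Δ (s i j) (difference Cji≡1) }
      where
      difference : ∀ {i j} → C i j ≡ 1ℤ → ∀ z → ⟨ root (s j i) , z ⟩ ≡ ⟨ root i , z ⟩ - ⟨ root j , z ⟩
      difference {i} {j} Cij≡1 z = trans (pair-s j i z)
        (cong (λ u → ⟨ root i , z ⟩ - u) (trans (cong (_* ⟨ root j , z ⟩) Cij≡1) (ℤ.*-identityˡ ⟨ root j , z ⟩)))

    -- Replacing each coefficient by its absolute value does not increase the
    -- norm of a combination of Δ, and y is positive on Δ.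
    independent : ∀ a → SupportedOn Δ a → combination X root a X.≈ᴹ X.0ᴹ → ∀ i → a i ≡ 0ℤ
    independent a supp a≈0 i = case ℤ.i*j≡0⇒i≡0∨j≡0 (∣a∣ i) (terms i) of λ
      { (inj₁ ∣ai∣≡0) → ℤ.∣i∣≡0⇒i≡0 (ℤ.+-injective ∣ai∣≡0)
      ; (inj₂ hi≡0)   → contradiction hi≡0 (regular i) }
      where
      ∣a∣ : Fin #Φ → ℤ
      ∣a∣ j = + ℤ.∣ a j ∣
      at : (Fin #Φ → ℤ) → Fin #Φ → ℤ
      at b k = sum (λ j → b j * C j k)
      relation : ∀ k → at a k ≡ 0ℤ
      relation k = trans (sym (Functional.combination-homo X (linearˡ (coroot k)) root a))
        (trans (⟨⟩-congˡ (coroot k) a≈0) (Functional.0ᴹ-homo X (linearˡ (coroot k))))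
      off-diagonal : ∀ i j → i ∈ Δ → j ∈ Δ → i ≢ j → ∣a∣ i * ∣a∣ j * form i j ≤ a i * a j * form i j
      off-diagonal i j i∈Δ j∈Δ i≢j = ℤ.*-monoʳ-≤-nonPos (form i j) {{ℤ.nonPositive form≤0}}
        (subst (a i * a j ≤_) (trans (cong +_ (ℤ.abs-* (a i) (a j))) (ℤ.pos-* ℤ.∣ a i ∣ ℤ.∣ a j ∣)) (i≤∣i∣ (a i * a j)))
        where
        form≤0 : form i j ≤ 0ℤ
        form≤0 = ℤ.*-cancelˡ-≤-pos (form i j) 0ℤ (+ 2) (subst (_≤ 0ℤ) (sym (2*form i j))
          (ℤ.*-monoʳ-≤-nonNeg (L j) {{ℤ.nonNegative (ℤ.<⇒≤ (L-pos j))}} (obtuse i∈Δ j∈Δ i≢j)))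
      term : ∀ i j → ∣a∣ i * ∣a∣ j * form i j ≤ a i * a j * form i j
      term i j with i Fin.≟ j | indecomposable? i | indecomposable? j
      ... | yes refl | _ | _ = ℤ.≤-reflexive (cong (_* form i i) (∣i∣*∣i∣ (a i)))
      ... | no i≢j | yes p | yes q = off-diagonal i j (∈-comprehension⁺ indecomposable? p) (∈-comprehension⁺ indecomposable? q) i≢j
      ... | no _ | no ¬p | _ rewrite supp {i} (¬p ∘ ∈-comprehension⁻ indecomposable?) = ℤ.≤-refl
      ... | no _ | yes _ | no ¬q rewrite supp {j} (¬q ∘ ∈-comprehension⁻ indecomposable?) =
              ℤ.≤-reflexive (cong (_* form i j) (trans (ℤ.*-zeroʳ (∣a∣ i)) (sym (ℤ.*-zeroʳ (a i)))))
      norm≤0 : sum (λ k → at ∣a∣ k * at ∣a∣ k) ≤ 0ℤ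
      norm≤0 = begin
        sum (λ k → at ∣a∣ k * at ∣a∣ k)                             ≡⟨ gram ∣a∣ C ⟩
        sum (λ i → sum (λ j → ∣a∣ i * ∣a∣ j * form i j))             ≤⟨ sum-mono (λ i → sum-mono (λ j → term i j)) ⟩
        sum (λ i → sum (λ j → a i * a j * form i j))                ≡⟨ gram a C ⟨
        sum (λ k → at a k * at a k)                                 ≡⟨ sum-zero (λ k → cong (λ u → u * u) (relation k)) ⟩
        0ℤ                                                          ∎
        where open ℤ.≤-Reasoning
      orthogonal : ∀ k → ⟨ combination X root ∣a∣ , coroot k ⟩ ≡ 0ℤ
      orthogonal k = trans (Functional.combination-homo X (linearˡ (coroot k)) root ∣a∣)
        (square-zero (nonneg-sum-zero (λ k → square-nonneg (at ∣a∣ k)) norm≤0 k))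
      -- Zero norm yields orthogonality to the coroots only; `radical` converts it into height zero,
      -- which is a sum of nonnegative terms.
      height≡0 : sum (λ j → ∣a∣ j * ⟨ root j , y ⟩) ≡ 0ℤ
      height≡0 = trans (sym (Functional.combination-homo X (linearˡ y) root ∣a∣)) (radical _ orthogonal)
      nonneg : ∀ j → 0ℤ ≤ ∣a∣ j * ⟨ root j , y ⟩
      nonneg j with indecomposable? j
      ... | yes (pos , _) = *-nonneg {∣a∣ j} (ℤ.+≤+ z≤n) (ℤ.<⇒≤ pos)
      ... | no ¬p rewrite supp {j} (¬p ∘ ∈-comprehension⁻ indecomposable?) = ℤ.≤-refl
      terms : ∀ j → ∣a∣ j * ⟨ root j , y ⟩ ≡ 0ℤ
      terms = nonneg-sum-zero nonneg (ℤ.≤-reflexive height≡0)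

    isBasis : IsBasis Δ
    isBasis = record { independent = independent ; same-sign = same-sign }

-- Coefficients with respect to a base

module Coefficients {c ℓ} (R : RootDatum c ℓ) (isSimple : IsSimple R) where
  open RootDatum R
  open Datum R using (C; s; pair-s; ⟨⟩-congˡ)
  open Simple R isSimple using (system; root-sᵢᵢ)
  open Cartan system using (dual)

  module _ {Δ : Subset #Φ} (basis : IsBasis Δ) where
    open IsBasis basis

    coefficient : Fin #Φ → Fin #Φ → ℤ
    coefficient i = proj₁ (same-sign i)

    coefficient-supported : ∀ i → SupportedOn Δ (coefficient i)
    coefficient-supported i = proj₁ (proj₂ (same-sign i))

    expansion : ∀ i z → ⟨ root i , z ⟩ ≡ sum (λ j → coefficient i j * ⟨ root j , z ⟩)
    expansion i z = trans (⟨⟩-congˡ z (proj₁ (proj₂ (proj₂ (same-sign i)))))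
                          (Functional.combination-homo X (linearˡ z) root (coefficient i))

    supported-term : ∀ {a} → SupportedOn Δ a → ∀ (f g : Fin #Φ → ℤ) → (∀ {j} → j ∈ Δ → f j ≡ g j) →
                     ∀ j → a j * f j ≡ a j * g j
    supported-term {a} supp f g f≡g j with j ∈? Δ
    ... | yes j∈Δ = cong (a j *_) (f≡g j∈Δ)
    ... | no  j∉Δ rewrite supp j∉Δ = refl

    determined-on-basis : ∀ z w → (∀ {j} → j ∈ Δ → ⟨ root j , z ⟩ ≡ ⟨ root j , w ⟩) → ∀ i → ⟨ root i , z ⟩ ≡ ⟨ root i , w ⟩
    determined-on-basis z w eq i = begin
      ⟨ root i , z ⟩                                  ≡⟨ expansion i z ⟩
      sum (λ j → coefficient i j * ⟨ root j , z ⟩)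
        ≡⟨ sum-cong-≗ (supported-term (coefficient-supported i) _ _ eq) ⟩
      sum (λ j → coefficient i j * ⟨ root j , w ⟩)    ≡⟨ expansion i w ⟨
      ⟨ root i , w ⟩                                  ∎
      where open ≡-Reasoning

    unique-combination : ∀ {a b} → SupportedOn Δ a → SupportedOn Δ b →
      (∀ z → sum (λ j → a j * ⟨ root j , z ⟩) ≡ sum (λ j → b j * ⟨ root j , z ⟩)) → ∀ j → a j ≡ b j
    unique-combination {a} {b} a-supp b-supp eq j = ℤ.i-j≡0⇒i≡j (a j) (b j)
      (trans (sym (ones (a j) (b j))) (independent d (λ j∉Δ → cong₂ (λ u v → 1ℤ * u + -1ℤ * v) (a-supp j∉Δ) (b-supp j∉Δ))
        (separatesʳ λ z → begin
          ⟨ combination X root d , z ⟩                      ≡⟨ Functional.combination-homo X (linearˡ z) root d ⟩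
          sum (λ j → d j * ⟨ root j , z ⟩)                  ≡⟨ sum-cong-≗ (λ j → expand (a j) (b j) (⟨_,_⟩ (root j) z)) ⟩
          sum (λ j → 1ℤ * (a j * ⟨ root j , z ⟩) + -1ℤ * (b j * ⟨ root j , z ⟩))
            ≡⟨ sum-linear 1ℤ -1ℤ (λ j → a j * ⟨ root j , z ⟩) (λ j → b j * ⟨ root j , z ⟩) ⟩
          1ℤ * sum (λ j → a j * ⟨ root j , z ⟩) + -1ℤ * sum (λ j → b j * ⟨ root j , z ⟩)
            ≡⟨ cong (λ u → 1ℤ * u + -1ℤ * sum (λ j → b j * ⟨ root j , z ⟩)) (eq z) ⟩
          1ℤ * sum (λ j → b j * ⟨ root j , z ⟩) + -1ℤ * sum (λ j → b j * ⟨ root j , z ⟩)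
            ≡⟨ cancel (sum (λ j → b j * ⟨_,_⟩ (root j) z)) ⟩
          0ℤ                                                ≡⟨ Functional.0ᴹ-homo X (linearˡ z) ⟨
          ⟨ X.0ᴹ , z ⟩                                      ∎) j))
      where
      open ≡-Reasoning
      d : Fin #Φ → ℤ
      d j = 1ℤ * a j + -1ℤ * b j
      ones : ∀ x y → 1ℤ * x + -1ℤ * y ≡ x - y
      ones = solve-∀
      expand : ∀ x y w → (1ℤ * x + -1ℤ * y) * w ≡ 1ℤ * (x * w) + -1ℤ * (y * w)
      expand = solve-∀
      cancel : ∀ x → 1ℤ * x + -1ℤ * x ≡ 0ℤ
      cancel = solve-∀

    -- The coefficients are merely chosen for each root, but independence of the base makes
    -- expansions unique and hence linear. This qualifies a coefficient as an argument of
    -- `disjoint-supports`.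
    coefficient-additive : ∀ j → Cartan.CorootAdditive dual (λ i → coefficient i j)
    coefficient-additive j i k = trans (unique-combination (coefficient-supported (s i k)) supported eq j)
                                       (ones (coefficient k j) (C k i) (coefficient i j))
      where
      open ≡-Reasoning
      d : Fin #Φ → ℤ
      d l = 1ℤ * coefficient k l + - C k i * coefficient i l
      ones : ∀ x y z → 1ℤ * x + - y * z ≡ x - y * z
      ones = solve-∀
      expand : ∀ x y z w → (1ℤ * x + - y * z) * w ≡ 1ℤ * (x * w) + - y * (z * w)
      expand = solve-∀
      supported : SupportedOn Δ d
      supported l∉Δ = trans (cong₂ (λ u v → 1ℤ * u + - C k i * v) (coefficient-supported k l∉Δ) (coefficient-supported i l∉Δ))
                            (trans (ℤ.+-identityˡ _) (ℤ.*-zeroʳ (- C k i)))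
      eq : ∀ z → sum (λ l → coefficient (s i k) l * ⟨ root l , z ⟩) ≡ sum (λ l → d l * ⟨ root l , z ⟩)
      eq z = begin
        sum (λ l → coefficient (s i k) l * r l)   ≡⟨ expansion (s i k) z ⟨
        r (s i k)                                 ≡⟨ pair-s i k z ⟩
        r k - C k i * r i                         ≡⟨ ones (r k) (C k i) (r i) ⟨
        1ℤ * r k + - C k i * r i
          ≡⟨ cong₂ (λ u v → 1ℤ * u + - C k i * v) (expansion k z) (expansion i z) ⟩
        1ℤ * sum (λ l → coefficient k l * r l) + - C k i * sum (λ l → coefficient i l * r l)
          ≡⟨ sum-linear 1ℤ (- C k i) (λ l → coefficient k l * r l) (λ l → coefficient i l * r l) ⟨
        sum (λ l → 1ℤ * (coefficient k l * r l) + - C k i * (coefficient i l * r l))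
          ≡⟨ sum-cong-≗ (λ l → expand (coefficient k l) (C k i) (coefficient i l) (r l)) ⟨
        sum (λ l → d l * r l)                     ∎
        where
        r : Fin #Φ → ℤ
        r l = ⟨ root l , z ⟩

    coefficient-basis : ∀ {i} → i ∈ Δ → ∀ j → coefficient i j ≡ (if does (i Fin.≟ j) then 1ℤ else 0ℤ)
    coefficient-basis {i} i∈Δ = unique-combination (coefficient-supported i) supported
      (λ z → trans (sym (expansion i z)) (sym (sum-unit i (λ j → ⟨ root j , z ⟩))))
      where
      supported : SupportedOn Δ (λ j → if does (i Fin.≟ j) then 1ℤ else 0ℤ)
      supported {j} j∉Δ with i Fin.≟ j
      ... | yes refl = contradiction i∈Δ j∉Δ
      ... | no _     = refl

    coefficient-neg : ∀ i j → coefficient (s i i) j ≡ - coefficient i j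
    coefficient-neg i j = Cartan.additive-neg dual (λ i → coefficient i j) (coefficient-additive j) i

    module _ (z : ∣ Y ∣) where

      F : Fin #Φ → ℤ
      F i = ⟨ root i , z ⟩

      F-additive : Cartan.CorootAdditive dual F
      F-additive i j = pair-s i j z

      Dominant : Set
      Dominant = ∀ {j} → j ∈ Δ → 0ℤ ≤ F j

      -- At a root with value 2 u, reflection in the neighbour `j` leads to a root on which `F`
      -- vanishes, since 2 u - 2 * u = 0.
      Bounded : ℤ → Set
      Bounded u = ∀ i → 0ℤ < F i → F i ≡ u ⊎ (F i ≡ + 2 * u × ¬ ¬ (∃[ j ] F j ≡ u × C i j ≡ + 2))

      -- The product of `p` and `q` is zero because dominance gives 0 ≤ p i * u ≤ F i on roots with
      -- nonnegative coefficients, where `F` is 0, u or 2 u. At the lower end p i = 0, at the upper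
      -- end q i = 0; the only value in between, p i = 1 with F i = 2 u, is excluded by parity.
      sole-nonzero : ∀ {u γ} → 0ℤ < u → Dominant → Bounded u → γ ∈ Δ → F γ ≡ u →
                     ∀ {j} → j ∈ Δ → j ≢ γ → F j ≡ 0ℤ
      sole-nonzero {u} {γ} 0<u dominant bounded γ∈Δ Fγ≡u {j} j∈Δ j≢γ = begin
        F j             ≡⟨ ℤ.i-j≡0⇒i≡j (F j) _ (disjoint-supports system p q (coefficient-additive γ) q-additive p*q≡0 pγ≢0 j) ⟩
        u * p j         ≡⟨ cong (u *_) pj≡0 ⟩
        u * 0ℤ          ≡⟨ ℤ.*-zeroʳ u ⟩
        0ℤ              ∎
        where
        open ≡-Reasoning
        p q : Fin #Φ → ℤ
        p i = coefficient i γ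
        q i = F i - u * p i
        q-additive : Cartan.CorootAdditive dual q
        q-additive i k = trans (cong₂ (λ v w → v - u * w) (F-additive i k) (coefficient-additive γ i k))
          (shuffle (F k) (C k i) (F i) u (p k) (p i))
          where
          shuffle : ∀ a b c d e f → (a - b * c) - d * (e - b * f) ≡ (a - d * e) - b * (c - d * f)
          shuffle = solve-∀
        pγ≢0 : p γ ≢ 0ℤ
        pγ≢0 eq with γ Fin.≟ γ | coefficient-basis γ∈Δ γ
        ... | yes _ | eq′ = contradiction (trans (sym eq′) eq) λ ()
        ... | no γ≢γ | _  = γ≢γ refl
        pj≡0 : p j ≡ 0ℤ
        pj≡0 with j Fin.≟ γ | coefficient-basis j∈Δ γ
        ... | yes j≡γ | _ = contradiction j≡γ j≢γ
        ... | no _ | eq′  = eq′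
        Effective : Fin #Φ → Set
        Effective i = ∀ k → 0ℤ ≤ coefficient i k
        up-to-sign : ∀ i → Effective i ⊎ Effective (s i i)
        up-to-sign i with proj₂ (proj₂ (proj₂ (same-sign i)))
        ... | inj₁ 0≤a = inj₁ 0≤a
        ... | inj₂ a≤0 = inj₂ λ k → subst (0ℤ ≤_) (sym (coefficient-neg i k)) (ℤ.neg-mono-≤ (a≤0 k))
        F-neg : ∀ i → F (s i i) ≡ - F i
        F-neg i = root-sᵢᵢ i z
        bound : ∀ {i} → Effective i → p i * u ≤ F i
        bound {i} effective = subst₂ _≤_ (cong (p i *_) Fγ≡u) (sym (expansion i z)) (term≤sum terms γ)
          where
          terms : ∀ k → 0ℤ ≤ coefficient i k * F k
          terms k with k ∈? Δ
          ... | yes k∈Δ = *-nonneg (effective k) (dominant k∈Δ)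
          ... | no  k∉Δ rewrite coefficient-supported i k∉Δ = ℤ.≤-refl
        p-bound : ∀ {i} → Effective i → ∀ m → F i ≡ m * u → p i ≤ m
        p-bound {i} effective m Fi≡mu = ℤ.*-cancelʳ-≤-pos (p i) m u {{ℤ.positive 0<u}} (subst (p i * u ≤_) Fi≡mu (bound effective))
        zero-effective : ∀ {i} → Effective i → F i ≡ 0ℤ → p i ≡ 0ℤ
        zero-effective effective Fi≡0 = ℤ.≤-antisym (p-bound effective 0ℤ Fi≡0) (effective γ)
        zero-zero : ∀ i → F i ≡ 0ℤ → p i ≡ 0ℤ
        zero-zero i Fi≡0 with up-to-sign i
        ... | inj₁ effective = zero-effective effective Fi≡0
        ... | inj₂ effective = ℤ.neg-injective (trans (sym (coefficient-neg i γ))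
                (zero-effective effective (trans (F-neg i) (cong -_ Fi≡0))))
        double : ∀ {i} → Effective i → F i ≡ + 2 * u → ¬ ¬ (∃[ j ] F j ≡ u × C i j ≡ + 2) → p i * q i ≡ 0ℤ
        double {i} effective Fi≡2u ¬¬∃ = cases (p i) refl (effective γ) (p-bound effective (+ 2) Fi≡2u)
          where
          cases : ∀ m → p i ≡ m → 0ℤ ≤ m → m ≤ + 2 → m * q i ≡ 0ℤ
          cases (+ 0) _ _ _ = refl
          -- Reflection in the neighbour `j` reaches a root where `F`, and therefore `p`, is zero,
          -- although `p` equals the odd number 1 - 2 * p j there.
          cases (+ 1) pi≡1 _ _ = contradiction (λ (j , Fj≡u , Cij≡2) →
            odd (p j) (trans (sym (trans (coefficient-additive γ j i) (cong₂ (λ v w → v - w * p j) pi≡1 Cij≡2)))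
              (zero-zero (s j i) (trans (F-additive j i) (trans (cong₂ (λ v w → v - w) Fi≡2u (cong₂ _*_ Cij≡2 Fj≡u))
                (ℤ.+-inverseʳ (+ 2 * u))))))) ¬¬∃
            where
            odd : ∀ x → 1ℤ - + 2 * x ≢ 0ℤ
            odd x eq = contradiction (ℕ.m*n≡1⇒m≡1 2 ℤ.∣ x ∣ (trans (sym (ℤ.abs-* (+ 2) x))
              (cong ℤ.∣_∣ (sym (ℤ.i-j≡0⇒i≡j 1ℤ (+ 2 * x) eq))))) λ ()
          cases (+ 2) pi≡2 _ _ = cong (+ 2 *_) (trans (cong₂ (λ v w → v - u * w) Fi≡2u pi≡2)
            (trans (cong (λ v → v - u * + 2) (ℤ.*-comm (+ 2) u)) (ℤ.+-inverseʳ (u * + 2))))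
          cases (+ (ℕ.suc (ℕ.suc (ℕ.suc _)))) _ _ (ℤ.+≤+ (s≤s (s≤s ())))
        effective-case : ∀ {i} → Effective i → p i * q i ≡ 0ℤ
        effective-case {i} effective with ℤ.<-cmp 0ℤ (F i)
        ... | tri≈ _ 0≡Fi _ = cong (_* q i) (zero-effective effective (sym 0≡Fi))
        ... | tri> _ _ Fi<0 = contradiction (ℤ.≤-trans (*-nonneg (effective γ) (ℤ.<⇒≤ 0<u)) (bound effective)) (ℤ.<⇒≱ Fi<0)
        ... | tri< 0<Fi _ _ with bounded i 0<Fi
        ...   | inj₂ (Fi≡2u , ¬¬∃) = double effective Fi≡2u ¬¬∃
        ...   | inj₁ Fi≡u = cases (p i) refl (effective γ) (p-bound effective 1ℤ (trans Fi≡u (sym (ℤ.*-identityˡ u))))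
          where
          cases : ∀ m → p i ≡ m → 0ℤ ≤ m → m ≤ 1ℤ → m * q i ≡ 0ℤ
          cases (+ 0) _ _ _ = refl
          cases (+ 1) pi≡1 _ _ = cong (1ℤ *_) (trans (cong₂ (λ v w → v - u * w) Fi≡u pi≡1)
            (trans (cong (λ v → u - v) (ℤ.*-identityʳ u)) (ℤ.+-inverseʳ u)))
          cases (+ (ℕ.suc (ℕ.suc _))) _ _ (ℤ.+≤+ (s≤s ()))
        p*q≡0 : ∀ i → p i * q i ≡ 0ℤ
        p*q≡0 i with up-to-sign i
        ... | inj₁ effective = effective-case effective
        ... | inj₂ effective = trans (sym (trans (cong₂ _*_ (coefficient-neg i γ)
                (Cartan.additive-neg dual q q-additive i)) (neg-*-neg (p i) (q i)))) (effective-case effective)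
          where
          neg-*-neg : ∀ x y → - x * - y ≡ x * y
          neg-*-neg = solve-∀

-- A base adapted to a functional

module Adapted {c ℓ} (R : RootDatum c ℓ) (isSimple : IsSimple R) where
  open RootDatum R
  open Datum R using (C; s; pair-s)
  open Simple R isSimple using (root-sᵢᵢ)
  open Bases R isSimple
  open Chamber R isSimple
  open Coefficients R isSimple using (determined-on-basis; sole-nonzero)

  module _ (z : ∣ Y ∣) (u : ℤ) (0<u : 0ℤ < u) where

    F : Fin #Φ → ℤ
    F i = ⟨ root i , z ⟩

    -- Such a root is a sum of two positive roots in every chamber on which F
    -- is dominant.
    HasShortcut : Fin #Φ → Set
    HasShortcut i = (F i ≡ u × ¬ ¬ (∃[ j ] F j ≡ u × C i j ≡ 1ℤ × C j i ≡ + 2))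
                  ⊎ (F i ≡ + 2 * u × ¬ ¬ (∃[ j ] F j ≡ u × C i j ≡ + 2 × C j i ≡ 1ℤ))

    module _ (y : ∣ Y ∣) (radical : Radical y) (regular : Regular y) (adapted : y ≽ z) where

      Fj≡u⇒pos : ∀ {j} → F j ≡ u → Pos y radical regular j
      Fj≡u⇒pos {j} eq = adapted j (subst (0ℤ <_) (sym eq) 0<u)

      shortcut⇒decomposable : ∀ {i} → HasShortcut i → ¬ ¬ Decomposable y radical regular i
      shortcut⇒decomposable {i} (inj₁ (Fi≡u , ¬¬∃)) ¬dec = ¬¬∃ λ (j , Fj≡u , Cij≡1 , Cji≡2) → ¬dec (decompose j Fj≡u Cij≡1 Cji≡2)
        where
        decompose : ∀ j → F j ≡ u → C i j ≡ 1ℤ → C j i ≡ + 2 → Decomposable y radical regular i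
        decompose j Fj≡u Cij≡1 Cji≡2 with pos? y radical regular (s j i)
        ... | yes pos = s j i , j , pos , Fj≡u⇒pos Fj≡u , λ w →
                trans (sym (identity ⟨ root i , w ⟩ ⟨ root j , w ⟩))
                  (cong (_+ ⟨ root j , w ⟩) (trans (cong (λ v → ⟨ root i , w ⟩ - v * ⟨ root j , w ⟩) (sym Cij≡1)) (sym (pair-s j i w))))
          where
          identity : ∀ a b → a - 1ℤ * b + b ≡ a
          identity = solve-∀
        -- Now α_j - α_i is positive, and α_i = (2 α_i - α_j) + (α_j - α_i). The first summand is
        -- the opposite of the reflection of α_j in α_i, with `F` equal to 2 u - u = u.
        ... | no ¬pos = s t t , s k k , Fj≡u⇒pos Ft≡u , ¬pos⇒pos-s y radical regular ¬pos , λ w →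
                trans (sym (identity ⟨ root i , w ⟩ ⟨ root j , w ⟩)) (sym (cong₂ _+_ (t-value w) (k-value w)))
          where
          k t : Fin #Φ
          k = s j i
          t = s i j
          k-value : ∀ w → ⟨ root (s k k) , w ⟩ ≡ - (⟨ root i , w ⟩ - 1ℤ * ⟨ root j , w ⟩)
          k-value w = trans (root-sᵢᵢ k w) (cong -_ (trans (pair-s j i w) (cong (λ v → ⟨ root i , w ⟩ - v * ⟨ root j , w ⟩) Cij≡1)))
          t-value : ∀ w → ⟨ root (s t t) , w ⟩ ≡ - (⟨ root j , w ⟩ - + 2 * ⟨ root i , w ⟩)
          t-value w = trans (root-sᵢᵢ t w) (cong -_ (trans (pair-s i j w) (cong (λ v → ⟨ root j , w ⟩ - v * ⟨ root i , w ⟩) Cji≡2)))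
          identity : ∀ a b → - (b - + 2 * a) + - (a - 1ℤ * b) ≡ a
          identity = solve-∀
          collapse : ∀ a → - (a - + 2 * a) ≡ a
          collapse = solve-∀
          Ft≡u : F (s t t) ≡ u
          Ft≡u = trans (t-value z) (trans (cong₂ (λ a b → - (a - + 2 * b)) Fj≡u Fi≡u) (collapse u))
      shortcut⇒decomposable {i} (inj₂ (Fi≡2u , ¬¬∃)) ¬dec = ¬¬∃ λ (j , Fj≡u , _ , Cji≡1) → ¬dec (decompose j Fj≡u Cji≡1)
        where
        decompose : ∀ j → F j ≡ u → C j i ≡ 1ℤ → Decomposable y radical regular i
        -- Here α_i = α_j + (α_i - α_j), where the second summand is the opposite of the reflection
        -- of α_j in α_i; `F` is u on both.
        decompose j Fj≡u Cji≡1 = j , s k k , Fj≡u⇒pos Fj≡u , Fj≡u⇒pos Fk≡u , λ w →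
            trans (sym (identity ⟨ root i , w ⟩ ⟨ root j , w ⟩)) (cong (λ v → ⟨ root j , w ⟩ + v) (sym (k-value w)))
          where
          k : Fin #Φ
          k = s i j
          k-value : ∀ w → ⟨ root (s k k) , w ⟩ ≡ - (⟨ root j , w ⟩ - 1ℤ * ⟨ root i , w ⟩)
          k-value w = trans (root-sᵢᵢ k w) (cong -_ (trans (pair-s i j w) (cong (λ v → ⟨ root j , w ⟩ - v * ⟨ root i , w ⟩) Cji≡1)))
          identity : ∀ a b → b + - (b - 1ℤ * a) ≡ a
          identity = solve-∀
          collapse : ∀ a → - (a - 1ℤ * (+ 2 * a)) ≡ a
          collapse = solve-∀
          Fk≡u : F (s k k) ≡ u
          Fk≡u = trans (k-value z) (trans (cong₂ (λ a b → - (a - 1ℤ * b)) Fj≡u Fi≡2u) (collapse u))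

    -- `Good` keeps what `F γ ≡ u` forgets: for characters `F` is u both where f = a and where f = 2
    -- a, and γ has to be of the first kind.
    AdaptedBasis : (Fin #Φ → Set) → Set (c ⊔ ℓ)
    AdaptedBasis Good =
      ∃[ Δ ] ∃[ γ ] IsBasis Δ × γ ∈ Δ × Good γ × F γ ≡ u × (∀ {j} → j ∈ Δ → j ≢ γ → F j ≡ 0ℤ)

    -- `y₀` is separate from `z` since the chamber has to come from a `Radical` element, and `z` may
    -- be given without a proof of being one.
    adapted-basis : ∀ {Good : Fin #Φ → Set} y₀ → Radical y₀ → y₀ ≽ z → ∀ {i₀} → 0ℤ < F i₀ →
      (∀ i → 0ℤ < F i → (Good i × F i ≡ u) ⊎ HasShortcut i) → AdaptedBasis Good
    adapted-basis {Good} y₀ radical₀ y₀≽z {i₀} 0<Fi₀ classify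
      with (y , radical , y≽y₀ , regular) ← regularize y₀ radical₀ = result
      where
      Δ₀ : Subset #Φ
      Δ₀ = Δ y radical regular
      basis : IsBasis Δ₀
      basis = isBasis y radical regular
      adapted : y ≽ z
      adapted i = y≽y₀ i ∘ y₀≽z i
      dominant : ∀ {j} → j ∈ Δ₀ → 0ℤ ≤ F j
      dominant {j} j∈Δ = ℤ.≮⇒≥ λ Fj<0 → ℤ.<-asym
        (∈Δ⇒pos y radical regular j∈Δ)
        (ℤ.neg-cancel-< (subst (0ℤ <_) (root-sᵢᵢ j y)
          (adapted (s j j) (subst (0ℤ <_) (sym (root-sᵢᵢ j z)) (ℤ.neg-mono-< Fj<0)))))
      bounded : ∀ i → 0ℤ < F i → F i ≡ u ⊎ (F i ≡ + 2 * u × ¬ ¬ (∃[ j ] F j ≡ u × C i j ≡ + 2))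
      bounded i 0<Fi = case classify i 0<Fi of λ
        { (inj₁ (_ , eq))        → inj₁ eq
        ; (inj₂ (inj₁ (eq , _))) → inj₁ eq
        ; (inj₂ (inj₂ (eq , ¬¬∃))) → inj₂ (eq , λ ¬∃ → ¬¬∃ λ (j , Fj≡u , Cij≡2 , _) → ¬∃ (j , Fj≡u , Cij≡2)) }
      result : AdaptedBasis Good
      result with Fin.any? (λ j → (j ∈? Δ₀) ×-dec ¬? (F j ℤ.≟ 0ℤ))
      ... | no ¬∃ = contradiction
              (trans (determined-on-basis basis z Y.0ᴹ (λ {j} j∈Δ → trans (zero-on-Δ j∈Δ) (sym (pair-0 j))) i₀) (pair-0 i₀))
              (pos⇒≢0 0<Fi₀)
        where
        pair-0 : ∀ j → ⟨ root j , Y.0ᴹ ⟩ ≡ 0ℤ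
        pair-0 j = Functional.0ᴹ-homo Y (linearʳ (root j))
        zero-on-Δ : ∀ {j} → j ∈ Δ₀ → F j ≡ 0ℤ
        zero-on-Δ {j} j∈Δ = decidable-stable (F j ℤ.≟ 0ℤ) λ Fj≢0 → ¬∃ (j , j∈Δ , Fj≢0)
      ... | yes (γ , γ∈Δ , Fγ≢0) with classify γ (ℤ.≤∧≢⇒< (dominant γ∈Δ) (Fγ≢0 ∘ sym))
      ...   | inj₂ shortcut = contradiction (∈Δ⇒indecomposable y radical regular γ∈Δ)
                                (shortcut⇒decomposable y radical regular adapted shortcut)
      ...   | inj₁ (good , Fγ≡u) = Δ₀ , γ , basis , γ∈Δ , good , Fγ≡u
                , sole-nonzero basis z 0<u dominant bounded γ∈Δ Fγ≡u

-- Rational quotients and divisibility of characters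

/-injective : ∀ {a d k} → a ℚ./ ℕ.suc d ≡ k ℚ./ 1 → a ≡ k * + ℕ.suc d
/-injective {a} {d} {k} eq with *≡* a*1≡k*d ← ℚ./-injective-≃ (mkℚᵘ a d) (mkℚᵘ k 0) eq =
  trans (sym (ℤ.*-identityʳ a)) a*1≡k*d

/-cancel : ∀ {a d k} → a ≡ k * + ℕ.suc d → a ℚ./ ℕ.suc d ≡ k ℚ./ 1
/-cancel {a} {d} {k} eq = ℚ.fromℚᵘ-cong {mkℚᵘ a d} {mkℚᵘ k 0} (*≡* (trans (ℤ.*-identityʳ a) eq))

∈[-1,0,1]⇒∈0± : ∀ {a d} → (a ℚ./ ℕ.suc d) ∈[-1,0,1] → a ∈0± + ℕ.suc d
∈[-1,0,1]⇒∈0± (inj₁ eq)        = inj₂ (inj₂ (trans (/-injective {k = -1ℤ} eq) (ℤ.-1*i≡-i _)))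
∈[-1,0,1]⇒∈0± (inj₂ (inj₁ eq)) = inj₁ (/-injective {k = 0ℤ} eq)
∈[-1,0,1]⇒∈0± (inj₂ (inj₂ eq)) = inj₂ (inj₁ (trans (/-injective {k = 1ℤ} eq) (ℤ.*-identityˡ _)))

∈0±⇒∈[-1,0,1] : ∀ {a d} → a ∈0± + ℕ.suc d → (a ℚ./ ℕ.suc d) ∈[-1,0,1]
∈0±⇒∈[-1,0,1] (inj₁ eq)        = inj₂ (inj₁ (/-cancel {k = 0ℤ} eq))
∈0±⇒∈[-1,0,1] (inj₂ (inj₁ eq)) = inj₂ (inj₂ (/-cancel {k = 1ℤ} (trans eq (sym (ℤ.*-identityˡ _)))))
∈0±⇒∈[-1,0,1] (inj₂ (inj₂ eq)) = inj₁ (/-cancel {k = -1ℤ} (trans eq (sym (ℤ.-1*i≡-i _))))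

neg-/1 : ∀ a → (- a) ℚ./ 1 ≡ ℚ.- (a ℚ./ 1)
neg-/1 (+ 0)      = refl
neg-/1 ℤ.+[1+ n ] = refl
neg-/1 ℤ.-[1+ n ] = sym (neg-involutive (ℤ.+[1+ n ] ℚ./ 1))
  where
  neg-involutive : ∀ p → ℚ.- (ℚ.- p) ≡ p
  neg-involutive (ℚ.mkℚ (+ 0) _ _)      = refl
  neg-involutive (ℚ.mkℚ ℤ.+[1+ _ ] _ _) = refl
  neg-involutive (ℚ.mkℚ ℤ.-[1+ _ ] _ _) = refl

/1-injective : ∀ {a b} → a ℚ./ 1 ≡ b ℚ./ 1 → a ≡ b
/1-injective {a} {b} eq = trans (/-injective {a} {0} {b} eq) (ℤ.*-identityʳ b)

÷-cancel : ∀ {p t} q .{{_ : ℚ.NonZero q}} → p ≡ t ℚ.* q → p ÷ q ≡ t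
÷-cancel {t = t} q refl = trans (ℚ.*-assoc t q (ℚ.1/ q)) (trans (cong (t ℚ.*_) (ℚ.*-inverseʳ q)) (ℚ.*-identityʳ t))

÷-injective : ∀ {p t} q .{{_ : ℚ.NonZero q}} → p ÷ q ≡ t → p ≡ t ℚ.* q
÷-injective {p} q refl = sym (trans (ℚ.*-assoc p (ℚ.1/ q) q) (trans (cong (p ℚ.*_) (ℚ.*-inverseˡ q)) (ℚ.*-identityʳ p)))

-1*/1 : ∀ b → (ℚ.- 1ℚ) ℚ.* (b ℚ./ 1) ≡ (- b) ℚ./ 1
-1*/1 b = trans (sym (ℚ.neg-distribˡ-* 1ℚ (b ℚ./ 1))) (trans (cong ℚ.-_ (ℚ.*-identityˡ (b ℚ./ 1))) (sym (neg-/1 b)))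

quotient∈⇒∈0± : ∀ {a b} .{{_ : ℚ.NonZero (b ℚ./ 1)}} → ((a ℚ./ 1) ÷ (b ℚ./ 1)) ∈[-1,0,1] → a ∈0± b
quotient∈⇒∈0± {a} {b} (inj₁ eq)        = inj₂ (inj₂ (/1-injective (trans (÷-injective (b ℚ./ 1) eq) (-1*/1 b))))
quotient∈⇒∈0± {a} {b} (inj₂ (inj₁ eq)) = inj₁ (/1-injective (trans (÷-injective (b ℚ./ 1) eq) (ℚ.*-zeroˡ (b ℚ./ 1))))
quotient∈⇒∈0± {a} {b} (inj₂ (inj₂ eq)) = inj₂ (inj₁ (/1-injective (trans (÷-injective (b ℚ./ 1) eq) (ℚ.*-identityˡ (b ℚ./ 1)))))

∈0±⇒quotient∈ : ∀ {a b} .{{_ : ℚ.NonZero (b ℚ./ 1)}} → a ∈0± b → ((a ℚ./ 1) ÷ (b ℚ./ 1)) ∈[-1,0,1]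
∈0±⇒quotient∈ {a} {b} (inj₁ refl)        = inj₂ (inj₁ (÷-cancel (b ℚ./ 1) (sym (ℚ.*-zeroˡ (b ℚ./ 1)))))
∈0±⇒quotient∈ {a} {b} (inj₂ (inj₁ refl)) = inj₂ (inj₂ (÷-cancel (b ℚ./ 1) (sym (ℚ.*-identityˡ (b ℚ./ 1)))))
∈0±⇒quotient∈ {a} {b} (inj₂ (inj₂ refl)) = inj₁ (÷-cancel (b ℚ./ 1) (sym (-1*/1 b)))

/1-nonZero : ∀ {b} → b ≢ 0ℤ → ℚ.NonZero (b ℚ./ 1)
/1-nonZero b≢0 = ℚ.≢-nonZero (b≢0 ∘ /1-injective {b = 0ℤ})

-- The instance is irrelevant and can only be refuted: for b = 0 its type is empty.
/1-nonZero⁻¹ : ∀ {b} → .(ℚ.NonZero (b ℚ./ 1)) → b ≢ 0ℤ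
/1-nonZero⁻¹ () refl

δ⁺ : ∀ {n} {i j : Fin n} {x d} → (j ≡ i → x ≡ + ℕ.suc d) → (j ≢ i → x ≡ 0ℤ) → x ℚ./ ℕ.suc d ≡ δ i j
δ⁺ {i = i} {j} on off with i Fin.≟ j
... | yes i≡j = /-cancel {k = 1ℤ} (trans (on (sym i≡j)) (sym (ℤ.*-identityˡ _)))
... | no  i≢j = /-cancel {k = 0ℤ} (off (i≢j ∘ sym))

δ⁻ : ∀ {n} {i j : Fin n} {x d} → x ℚ./ ℕ.suc d ≡ δ i j → (j ≡ i × x ≡ + ℕ.suc d) ⊎ (j ≢ i × x ≡ 0ℤ)
δ⁻ {i = i} {j} eq with i Fin.≟ j
... | yes i≡j = inj₁ (sym i≡j , trans (/-injective {k = 1ℤ} eq) (ℤ.*-identityˡ _))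
... | no  i≢j = inj₂ (i≢j ∘ sym , /-injective {k = 0ℤ} eq)

flip-pairing : ∀ {c ℓ} {X Y : ℤ-Module c ℓ} → PerfectPairing X Y → PerfectPairing Y X
flip-pairing P = record
  { ⟨_,_⟩       = flip ⟨_,_⟩
  ; linearˡ     = linearʳ
  ; linearʳ     = linearˡ
  ; separatesˡ  = separatesʳ
  ; separatesʳ  = separatesˡ
  ; representsˡ = representsʳ
  ; representsʳ = representsˡ
  }
  where open PerfectPairing P

module _ {c ℓ} {X Y : ℤ-Module c ℓ} (P : PerfectPairing X Y) where
  open PerfectPairing P
  private
    module X = LeftModule X
    module Y = LeftModule Y

  -- The quotient is defined on `Y` by chosen expansions in `v`, and the choice need not be linear.
  -- All laws are checked after multiplication by `a`, where the quotient becomes ⟨χ , -⟩;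
  -- perfectness then represents it by an element of `X`.
  divide : ∀ {n} {v : Fin n → ∣ Y ∣} → Spansℤ Y v → ∀ {a} → a ≢ 0ℤ → ∀ χ →
           (∀ k → ∃[ w ] ⟨ χ , v k ⟩ ≡ w * a) → ∃[ ξ ] χ X.≈ᴹ a X.*ₗ ξ
  divide {v = v} spans {a} a≢0 χ multiple = let (ξ , ξ≡φ) = representsʳ functional in
    ξ , separatesʳ λ y → trans (sym (a*φ y))
      (trans (cong (a *_) (sym (ξ≡φ y))) (sym (Functional.scalar-homo X (linearˡ y) a ξ)))
    where
    open ≡-Reasoning
    b : ∣ Y ∣ → _
    b y = proj₁ (spans y)
    w : _ → ℤ
    w k = proj₁ (multiple k)
    φ : ∣ Y ∣ → ℤ
    φ y = sum (λ k → b y k * w k)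
    shuffle : ∀ x y z → x * (y * z) ≡ y * (z * x)
    shuffle = solve-∀
    a*φ : ∀ y → a * φ y ≡ ⟨ χ , y ⟩
    a*φ y = begin
      a * φ y                            ≡⟨ *-distribˡ-sum a (λ k → b y k * w k) ⟩
      sum (λ k → a * (b y k * w k))      ≡⟨ sum-cong-≗ (λ k → shuffle a (b y k) (w k)) ⟩
      sum (λ k → b y k * (w k * a))      ≡⟨ sum-cong-≗ (λ k → cong (b y k *_) (proj₂ (multiple k))) ⟨
      sum (λ k → b y k * ⟨ χ , v k ⟩)    ≡⟨ Functional.combination-homo Y (linearʳ χ) v (b y) ⟨
      ⟨ χ , combination Y v (b y) ⟩      ≡⟨ Functional.⟦⟧-cong Y (linearʳ χ) (proj₂ (spans y)) ⟨
      ⟨ χ , y ⟩                          ∎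
    lift : ∀ {x y} → a * x ≡ a * y → x ≡ y
    lift {x} {y} = *-cancelˡ x y a≢0
    functional : IsFunctional Y φ
    functional = record
      { +ᴹ-isGroupHomomorphism = record
        { isMonoidHomomorphism = record
          { isMagmaHomomorphism = record
            { isRelHomomorphism = record
              { cong = λ {y} {y′} y≈y′ → lift (trans (a*φ y) (trans (Functional.⟦⟧-cong Y (linearʳ χ) y≈y′) (sym (a*φ y′)))) }
            ; homo = λ y y′ → lift (trans (a*φ _) (trans (Functional.+ᴹ-homo Y (linearʳ χ) y y′)
                (trans (cong₂ _+_ (sym (a*φ y)) (sym (a*φ y′))) (sym (ℤ.*-distribˡ-+ a (φ y) (φ y′))))))
            }
          ; ε-homo = lift (trans (a*φ _) (trans (Functional.0ᴹ-homo Y (linearʳ χ)) (sym (ℤ.*-zeroʳ a))))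
          }
        ; ⁻¹-homo = λ y → lift (trans (a*φ _) (trans (Functional.-ᴹ-homo Y (linearʳ χ) y)
            (trans (cong -_ (sym (a*φ y))) (ℤ.neg-distribʳ-* a (φ y)))))
        }
      ; *ₗ-homo = λ m y → lift (trans (a*φ _) (trans (Functional.scalar-homo Y (linearʳ χ) m y)
          (trans (cong (m *_) (sym (a*φ y))) (swap m a (φ y)))))
      }
      where
      swap : ∀ x y z → x * (y * z) ≡ y * (x * z)
      swap = solve-∀

-- The classification

positive⇒suc : ∀ {u} → 0ℤ < u → ∃[ d ] u ≡ + ℕ.suc d
positive⇒suc {ℤ.+[1+ d ]} _ = d , refl
positive⇒suc {+ 0} (ℤ.+<+ ())

∈0±⇒multiple : ∀ {x y} → x ∈0± y → ∃[ w ] x ≡ w * y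
∈0±⇒multiple (inj₁ eq)        = 0ℤ , eq
∈0±⇒multiple (inj₂ (inj₁ eq)) = 1ℤ , trans eq (sym (ℤ.*-identityˡ _))
∈0±⇒multiple (inj₂ (inj₂ eq)) = -1ℤ , trans eq (sym (ℤ.-1*i≡-i _))

module Classification {c ℓ} (R : RootDatum c ℓ) (isSimple : IsSimple R) where
  open RootDatum R
  open Datum R using (C; L; L′; s; pair-s; pair-s-coroot; pair-reflection; pair-coreflection)
  open Simple R isSimple using (system)
  open Cartan system using (dual; _·_; L-sym; L-pos; L≢0; L-·; CorootAdditive; 2*pairing)
  open Dichotomy system using (QuasiConstant; orbit-bound⇒quasi-constant; scale-quasi-constant; quasi-constant-cong)
  open Bases R isSimple using (Radical)
  open Adapted R isSimple using (HasShortcut; AdaptedBasis; adapted-basis)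
  open Coefficients R isSimple using (determined-on-basis)

  module Dual = Cartan dual

  Multipleˣ : ∣ X ∣ → Set (c ⊔ ℓ)
  Multipleˣ χ = ∃[ m ] ∃[ ξ ] χ X.≈ᴹ m X.*ₗ ξ × (Minusculeˣ (ι ξ) ⊎ Cominusculeˣ ξ)

  Multipleʸ : ∣ Y ∣ → Set (c ⊔ ℓ)
  Multipleʸ μ = ∃[ m ] ∃[ ν ] μ Y.≈ᴹ m Y.*ₗ ν × (Minusculeʸ (ι ν) ⊎ Cominusculeʸ ν)

  ·ʸ-coroot : ∀ σ i x → ⟨ x , σ ·ʸ coroot i ⟩ ≡ ⟨ x , coroot (σ · i) ⟩
  ·ʸ-coroot []      i x = refl
  ·ʸ-coroot (j ∷ σ) i x = begin
    ⟨ x , coreflection j (σ ·ʸ coroot i) ⟩                              ≡⟨ pair-coreflection j x (σ ·ʸ coroot i) ⟩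
    ⟨ x , σ ·ʸ coroot i ⟩ - ⟨ root j , σ ·ʸ coroot i ⟩ * ⟨ x , coroot j ⟩
      ≡⟨ cong₂ (λ u v → u - v * (⟨_,_⟩ x (coroot j))) (·ʸ-coroot σ i x) (·ʸ-coroot σ i (root j)) ⟩
    ⟨ x , coroot (σ · i) ⟩ - C j (σ · i) * ⟨ x , coroot j ⟩            ≡⟨ pair-s-coroot j (σ · i) x ⟨
    ⟨ x , coroot (s j (σ · i)) ⟩                                       ∎
    where open ≡-Reasoning

  ·ˣ-root : ∀ σ i y → ⟨ σ ·ˣ root i , y ⟩ ≡ ⟨ root (σ · i) , y ⟩
  ·ˣ-root []      i y = refl
  ·ˣ-root (j ∷ σ) i y = begin
    ⟨ reflection j (σ ·ˣ root i) , y ⟩                                  ≡⟨ pair-reflection j (σ ·ˣ root i) y ⟩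
    ⟨ σ ·ˣ root i , y ⟩ - ⟨ σ ·ˣ root i , coroot j ⟩ * ⟨ root j , y ⟩
      ≡⟨ cong₂ (λ u v → u - v * (⟨_,_⟩ (root j) y)) (·ˣ-root σ i y) (·ˣ-root σ i (coroot j)) ⟩
    ⟨ root (σ · i) , y ⟩ - C (σ · i) j * ⟨ root j , y ⟩                ≡⟨ pair-s j (σ · i) y ⟨
    ⟨ root (s j (σ · i)) , y ⟩                                         ∎
    where open ≡-Reasoning

  on-coroots : ∣ X ∣ → Fin #Φ → ℤ
  on-coroots x k = ⟨ x , coroot k ⟩

  on-roots : ∣ Y ∣ → Fin #Φ → ℤ
  on-roots y k = ⟨ root k , y ⟩

  on-coroots-additive : ∀ x → CorootAdditive (on-coroots x)
  on-coroots-additive x i j = pair-s-coroot i j x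

  on-roots-additive : ∀ y → Dual.CorootAdditive (on-roots y)
  on-roots-additive y i j = pair-s i j y

  quasi-constantˣ : ∀ {χ} → QuasiConstantˣ χ ⇔ QuasiConstant (on-coroots χ)
  quasi-constantˣ {χ} = mk⇔ to from
    where
    to : QuasiConstantˣ χ → QuasiConstant (on-coroots χ)
    to qc i σ ≢0 = subst (_∈0± on-coroots χ i) (·ʸ-coroot σ i χ)
      (quotient∈⇒∈0± {{/1-nonZero ≢0}} (qc i {{/1-nonZero ≢0}} σ))
    from : QuasiConstant (on-coroots χ) → QuasiConstantˣ χ
    from quasi i {{nonZero}} σ = ∈0±⇒quotient∈ {b = on-coroots χ i} {{nonZero}}
      (subst (_∈0± on-coroots χ i) (sym (·ʸ-coroot σ i χ)) (quasi i σ (/1-nonZero⁻¹ {on-coroots χ i} nonZero)))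

  quasi-constantʸ : ∀ {μ} → QuasiConstantʸ μ ⇔ QuasiConstant (on-roots μ)
  quasi-constantʸ {μ} = mk⇔ to from
    where
    to : QuasiConstantʸ μ → QuasiConstant (on-roots μ)
    to qc i σ ≢0 = subst (_∈0± on-roots μ i) (·ˣ-root σ i μ)
      (quotient∈⇒∈0± {{/1-nonZero ≢0}} (qc i {{/1-nonZero ≢0}} σ))
    from : QuasiConstant (on-roots μ) → QuasiConstantʸ μ
    from quasi i {{nonZero}} σ = ∈0±⇒quotient∈ {b = on-roots μ i} {{nonZero}}
      (subst (_∈0± on-roots μ i) (sym (·ˣ-root σ i μ)) (quasi i σ (/1-nonZero⁻¹ {on-roots μ i} nonZero)))

  -- The isomorphisms X_ℚ ≅ Y_ℚ given by the invariant forms, up to scalars.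
  corootSum : (Fin #Φ → ℤ) → ∣ Y ∣
  corootSum f = + 2 Y.*ₗ combination Y coroot f

  rootSum : (Fin #Φ → ℤ) → ∣ X ∣
  rootSum f = + 2 X.*ₗ combination X root f

  pair-corootSum : ∀ x f → ⟨ x , corootSum f ⟩ ≡ + 2 * sum (λ k → f k * ⟨ x , coroot k ⟩)
  pair-corootSum x f = trans (Functional.scalar-homo Y (linearʳ x) (+ 2) _)
    (cong (+ 2 *_) (Functional.combination-homo Y (linearʳ x) coroot f))

  pair-rootSum : ∀ f y → ⟨ rootSum f , y ⟩ ≡ + 2 * sum (λ k → f k * ⟨ root k , y ⟩)
  pair-rootSum f y = trans (Functional.scalar-homo X (linearˡ y) (+ 2) _)
    (cong (+ 2 *_) (Functional.combination-homo X (linearˡ y) root f))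

  -- The factor 2 in `corootSum` absorbs the 2 of α^∨ = 2 (α , -) / (α , α), so the value is
  -- integral without halving.
  root-corootSum : ∀ {f} → CorootAdditive f → ∀ i → ⟨ root i , corootSum f ⟩ ≡ f i * L i
  root-corootSum {f} additive i = trans (pair-corootSum (root i) f) (2*pairing f additive i)

  rootSum-coroot : ∀ {f} → Dual.CorootAdditive f → ∀ i → ⟨ rootSum f , coroot i ⟩ ≡ f i * L′ i
  rootSum-coroot {f} additive i = trans (pair-rootSum f (coroot i)) (Dual.2*pairing f additive i)

  corootSum-radical : ∀ f → Radical (corootSum f)
  corootSum-radical f x x⊥ = trans (pair-corootSum x f)
    (cong (+ 2 *_) (sum-zero (λ k → trans (cong (f k *_) (x⊥ k)) (ℤ.*-zeroʳ (f k)))))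

  positive-factor : ∀ {x y z} → 0ℤ < y → z ≡ x * y → 0ℤ < z → 0ℤ < x
  positive-factor {x} {y} 0<y eq 0<z = ℤ.*-cancelʳ-<-nonNeg y {{ℤ.nonNegative (ℤ.<⇒≤ 0<y)}} (subst (0ℤ <_) eq 0<z)

  -- Characters in the simply connected case

  module _ (simply-connected : SimplyConnected) where

    divideˣ : ∀ {χ a} → a ≢ 0ℤ → (∀ k → ∃[ w ] on-coroots χ k ≡ w * a) →
              ∃[ ξ ] χ X.≈ᴹ a X.*ₗ ξ × (∀ k → on-coroots χ k ≡ a * on-coroots ξ k)
    divideˣ {χ} {a} a≢0 multiple = let (ξ , χ≈aξ) = divide pairing simply-connected a≢0 χ multiple in
      ξ , χ≈aξ , λ k → trans (Functional.⟦⟧-cong X (linearˡ (coroot k)) χ≈aξ) (Functional.scalar-homo X (linearˡ (coroot k)) a ξ)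

    quasi-constant⇒multipleˣ : ∀ χ → QuasiConstantˣ χ → Multipleˣ χ
    quasi-constant⇒multipleˣ χ qc =
      [ uniform , two-lengths ]′ (Dichotomy.dichotomy system f additive quasi)
      where
      f : Fin #Φ → ℤ
      f = on-coroots χ
      additive : CorootAdditive f
      additive = on-coroots-additive χ
      quasi : QuasiConstant f
      quasi = Equivalence.to quasi-constantˣ qc
      uniform : Dichotomy.Uniform system f → Multipleˣ χ
      uniform (a , a≢0 , values) with (ξ , χ≈aξ , f≡aξ) ← divideˣ a≢0 (λ k → ∈0±⇒multiple (values k)) =
        a , ξ , χ≈aξ , inj₁ λ k → ∈0±⇒∈[-1,0,1] (∈0±-cancel a≢0
          (subst₂ _∈0±_ (f≡aξ k) (sym (ℤ.*-identityʳ a)) (values k)))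
      two-lengths : Dichotomy.TwoLengths system f → Multipleˣ χ
      two-lengths T = conclude (divideˣ a≢0 (Dichotomy.base∣ system f additive quasi T))
                               (adapted-basis z u 0<u z (corootSum-radical f) (λ _ → id) 0<Fbase classify)
                               (positive⇒suc 0<u)
        where
        open Dichotomy.TwoLengths T
        a l u : ℤ
        a = f base
        l = L base
        u = a * l
        a≢0 : a ≢ 0ℤ
        a≢0 = pos⇒≢0 base-pos
        0<u : 0ℤ < u
        0<u = *-pos base-pos (L-pos base)
        -- The dual of `χ`: it equals `u` at every root where `f` is positive, and z / u becomes the
        -- minuscule coweight. Being a combination of coroots, it also starts the search for the
        -- chamber.
        z : ∣ Y ∣
        z = corootSum f
        F-value : ∀ k → ⟨ root k , z ⟩ ≡ f k * L k
        F-value = root-corootSum additive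
        0<Fbase : 0ℤ < ⟨ root base , z ⟩
        0<Fbase = subst (0ℤ <_) (sym (F-value base)) 0<u
        F≡0⇒f≡0 : ∀ k → ⟨ root k , z ⟩ ≡ 0ℤ → f k ≡ 0ℤ
        F≡0⇒f≡0 k eq = [ id , (λ Lk≡0 → contradiction Lk≡0 (L≢0 k)) ]′ (ℤ.i*j≡0⇒i≡0∨j≡0 (f k) (trans (sym (F-value k)) eq))
        conclude : ∃[ ξ ] χ X.≈ᴹ a X.*ₗ ξ × (∀ k → f k ≡ a * on-coroots ξ k) →
                   AdaptedBasis z u 0<u (λ i → f i ≡ a) → ∃[ d ] u ≡ + ℕ.suc d → Multipleˣ χ
        conclude (ξ , χ≈aξ , f≡aξ) (Δ , γ , basis , γ∈Δ , fγ≡a , Fγ≡u , F≡0) (d , u≡suc) =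
          a , ξ , χ≈aξ , inj₂ (Δ , γ , basis , γ∈Δ
          , (λ {j} j∈Δ → δ⁺
              (λ { refl → *-cancelˡ (on-coroots ξ γ) 1ℤ a≢0 (trans (sym (f≡aξ γ)) (trans fγ≡a (sym (ℤ.*-identityʳ a)))) })
              (λ j≢γ → *-cancelˡ (on-coroots ξ j) 0ℤ a≢0
                (trans (sym (f≡aξ j)) (trans (F≡0⇒f≡0 j (F≡0 j∈Δ j≢γ)) (sym (ℤ.*-zeroʳ a))))))
          -- A `fraction` stores its denominator minus one, so with `u` equal to suc d this is z /
          -- u.
          , fraction z d
          , (λ {j} j∈Δ → δ⁺ (λ { refl → trans Fγ≡u u≡suc }) (F≡0 j∈Δ))
          , λ k → ∈0±⇒∈[-1,0,1] (subst₂ _∈0±_ (sym (F-value k)) u≡suc (Dichotomy.weight system f additive quasi T k)))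
        classify : ∀ i → 0ℤ < ⟨ root i , z ⟩ → (f i ≡ a × ⟨ root i , z ⟩ ≡ u) ⊎ HasShortcut z u 0<u i
        classify i 0<Fi with 0<fi ← positive-factor (L-pos i) (F-value i) 0<Fi
                        with Dichotomy.positive-values system f additive quasi T i 0<fi
        ... | inj₁ (fi≡a , Li≡l)   = inj₁ (fi≡a , trans (F-value i) (cong₂ _*_ fi≡a Li≡l))
        ... | inj₂ (fi≡2a , 2Li≡l) = inj₂ (inj₁
              ( trans (F-value i) (Dichotomy.positive-weight system f additive quasi T 0<fi)
              , ¬¬-map neighbour (Dichotomy.double-neighbour system f additive quasi T fi≡2a 2Li≡l)))
          where
          neighbour : ∃[ j ] f j ≡ a × C i j ≡ 1ℤ × C j i ≡ + 2 → ∃[ j ] ⟨ root j , z ⟩ ≡ u × C i j ≡ 1ℤ × C j i ≡ + 2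
          neighbour (j , fj≡a , Cij≡1 , Cji≡2) = j , trans (F-value j) (cong₂ _*_ fj≡a (begin
            L j           ≡⟨ ℤ.*-identityˡ (L j) ⟨
            1ℤ * L j      ≡⟨ cong (_* L j) Cij≡1 ⟨
            C i j * L j   ≡⟨ L-sym i j ⟨
            C j i * L i   ≡⟨ cong (_* L i) Cji≡2 ⟩
            + 2 * L i     ≡⟨ 2Li≡l ⟩
            l             ∎)) , Cij≡1 , Cji≡2
            where open ≡-Reasoning

  -- Cocharacters in the adjoint case

  module _ (adjoint : Adjoint) where

    divideʸ : ∀ {μ a} → a ≢ 0ℤ → (∀ k → ∃[ w ] on-roots μ k ≡ w * a) →
              ∃[ ν ] μ Y.≈ᴹ a Y.*ₗ ν × (∀ k → on-roots μ k ≡ a * on-roots ν k)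
    divideʸ {μ} {a} a≢0 multiple = let (ν , μ≈aν) = divide (flip-pairing pairing) adjoint a≢0 μ multiple in
      ν , μ≈aν , λ k → trans (Functional.⟦⟧-cong Y (linearʳ (root k)) μ≈aν) (Functional.scalar-homo Y (linearʳ (root k)) a ν)

    quasi-constant⇒multipleʸ : ∀ μ → QuasiConstantʸ μ → Multipleʸ μ
    quasi-constant⇒multipleʸ μ qc =
      [ uniform , two-lengths ]′ (Dichotomy.dichotomy dual f additive quasi)
      where
      f : Fin #Φ → ℤ
      f = on-roots μ
      additive : Dual.CorootAdditive f
      additive = on-roots-additive μ
      quasi : QuasiConstant f
      quasi = Equivalence.to quasi-constantʸ qc
      uniform : Dichotomy.Uniform dual f → Multipleʸ μ
      uniform (a , a≢0 , values) with (ν , μ≈aν , f≡aν) ← divideʸ a≢0 (λ k → ∈0±⇒multiple (values k)) =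
        a , ν , μ≈aν , inj₁ λ k → ∈0±⇒∈[-1,0,1] (∈0±-cancel a≢0
          (subst₂ _∈0±_ (f≡aν k) (sym (ℤ.*-identityʳ a)) (values k)))
      two-lengths : Dichotomy.TwoLengths dual f → Multipleʸ μ
      two-lengths T = conclude (divideʸ a≢0 (Dichotomy.base∣ dual f additive quasi T))
                               (adapted-basis μ a base-pos y₀ (corootSum-radical G) y₀≽μ base-pos classify)
                               (positive⇒suc 0<u)
        where
        open Dichotomy.TwoLengths T
        a l u : ℤ
        a = f base
        l = L′ base
        u = a * l
        a≢0 : a ≢ 0ℤ
        a≢0 = pos⇒≢0 base-pos
        0<u : 0ℤ < u
        0<u = *-pos base-pos (Dual.L-pos base)
        -- The dual of `μ`, whose quotient by `u` becomes the minuscule weight; the functional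
        -- adapted to the base is `μ` itself.
        x : ∣ X ∣
        x = rootSum f
        G : Fin #Φ → ℤ
        G = on-coroots x
        G-value : ∀ k → G k ≡ f k * L′ k
        G-value = rootSum-coroot additive
        Gγ≡u : ∀ {γ} → f γ ≡ a → G γ ≡ u
        Gγ≡u {γ} fγ≡a = trans (G-value γ)
          (Dichotomy.positive-weight dual f additive quasi T (subst (0ℤ <_) (sym fγ≡a) base-pos))
        -- Passing through both forms replaces `μ` by a combination of coroots, hence a `Radical`
        -- element, and multiplies its value at root `i` by the positive number L′ i * L i.
        y₀ : ∣ Y ∣
        y₀ = corootSum G
        y₀≽μ : ∀ i → 0ℤ < f i → 0ℤ < ⟨ root i , y₀ ⟩
        y₀≽μ i 0<fi = subst (0ℤ <_)
          (sym (trans (root-corootSum (on-coroots-additive x) i) (cong (_* L i) (G-value i))))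
          (*-pos (*-pos 0<fi (Dual.L-pos i)) (L-pos i))
        conclude : ∃[ ν ] μ Y.≈ᴹ a Y.*ₗ ν × (∀ k → f k ≡ a * on-roots ν k) →
                   AdaptedBasis μ a base-pos (λ i → f i ≡ a) → ∃[ d ] u ≡ + ℕ.suc d → Multipleʸ μ
        conclude (ν , μ≈aν , f≡aν) (Δ , γ , basis , γ∈Δ , _ , fγ≡a , f≡0) (d , u≡suc) =
          a , ν , μ≈aν , inj₂ (Δ , γ , basis , γ∈Δ
          , (λ {j} j∈Δ → δ⁺
              (λ { refl → *-cancelˡ (on-roots ν γ) 1ℤ a≢0 (trans (sym (f≡aν γ)) (trans fγ≡a (sym (ℤ.*-identityʳ a)))) })
              (λ j≢γ → *-cancelˡ (on-roots ν j) 0ℤ a≢0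
                (trans (sym (f≡aν j)) (trans (f≡0 j∈Δ j≢γ) (sym (ℤ.*-zeroʳ a))))))
          , fraction x d
          , (λ {j} j∈Δ → δ⁺
              (λ { refl → trans (Gγ≡u fγ≡a) u≡suc })
              (λ j≢γ → trans (G-value j) (cong (_* L′ j) (f≡0 j∈Δ j≢γ))))
          , λ k → ∈0±⇒∈[-1,0,1] (subst₂ _∈0±_ (sym (G-value k)) u≡suc (Dichotomy.weight dual f additive quasi T k)))
        classify : ∀ i → 0ℤ < f i → (f i ≡ a × f i ≡ a) ⊎ HasShortcut μ a base-pos i
        classify i 0<fi with Dichotomy.positive-values dual f additive quasi T i 0<fi
        ... | inj₁ (fi≡a , _)        = inj₁ (fi≡a , fi≡a)
        -- The neighbour is found in the dual system, whose Cartan integers are transposed; hence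
        -- the exchange of the two equations.
        ... | inj₂ (fi≡2a , 2L′i≡l) = inj₂ (inj₂ (fi≡2a
              , ¬¬-map (λ (j , fj≡a , Cji≡1 , Cij≡2) → j , fj≡a , Cij≡2 , Cji≡1)
                       (Dichotomy.double-neighbour dual f additive quasi T fi≡2a 2L′i≡l)))

  -- Both sides are linear in the root k and agree on Δ.
  weight-identity : ∀ {Δ} → IsBasis Δ → ∀ {i} x y d e →
    (∀ {j} → j ∈ Δ → (j ≡ i × ⟨ x , coroot j ⟩ ≡ d) ⊎ (j ≢ i × ⟨ x , coroot j ⟩ ≡ 0ℤ)) →
    (∀ {j} → j ∈ Δ → (j ≡ i × ⟨ root j , y ⟩ ≡ e) ⊎ (j ≢ i × ⟨ root j , y ⟩ ≡ 0ℤ)) →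
    ∀ k → e * (⟨ x , coroot k ⟩ * L k) ≡ d * L i * ⟨ root k , y ⟩
  weight-identity {Δ} basis {i} x y d e x-weight y-weight k =
    trans (sym (z-value k)) (trans (determined-on-basis basis z w agree k) (w-value k))
    where
    z w : ∣ Y ∣
    z = e Y.*ₗ corootSum (on-coroots x)
    w = (d * L i) Y.*ₗ y
    z-value : ∀ k → ⟨ root k , z ⟩ ≡ e * (⟨ x , coroot k ⟩ * L k)
    z-value k = trans (Functional.scalar-homo Y (linearʳ (root k)) e _)
      (cong (e *_) (root-corootSum (on-coroots-additive x) k))
    w-value : ∀ k → ⟨ root k , w ⟩ ≡ d * L i * ⟨ root k , y ⟩
    w-value k = Functional.scalar-homo Y (linearʳ (root k)) (d * L i) y
    agree : ∀ {j} → j ∈ Δ → ⟨ root j , z ⟩ ≡ ⟨ root j , w ⟩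
    agree {j} j∈Δ = trans (z-value j) (trans (compare (x-weight j∈Δ) (y-weight j∈Δ)) (sym (w-value j)))
      where
      compare : (j ≡ i × ⟨ x , coroot j ⟩ ≡ d) ⊎ (j ≢ i × ⟨ x , coroot j ⟩ ≡ 0ℤ) →
                (j ≡ i × ⟨ root j , y ⟩ ≡ e) ⊎ (j ≢ i × ⟨ root j , y ⟩ ≡ 0ℤ) →
                e * (⟨ x , coroot j ⟩ * L j) ≡ d * L i * ⟨ root j , y ⟩
      compare (inj₁ (refl , p)) (inj₁ (_ , q)) = trans (cong (λ v → e * (v * L i)) p)
        (trans (ℤ.*-comm e (d * L i)) (cong (d * L i *_) (sym q)))
      compare (inj₂ (_ , p)) (inj₂ (_ , q)) = trans (cong (λ v → e * (v * L j)) p)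
        (trans (ℤ.*-zeroʳ e) (sym (trans (cong (d * L i *_) q) (ℤ.*-zeroʳ (d * L i)))))
      compare (inj₁ (j≡i , _)) (inj₂ (j≢i , _)) = contradiction j≡i j≢i
      compare (inj₂ (j≢i , _)) (inj₁ (j≡i , _)) = contradiction j≡i j≢i

  -- Quasi-constancy of minuscule and cominuscule elements

  minuscule⇒quasi-constant : ∀ {f} → (∀ k → (f k ℚ./ 1) ∈[-1,0,1]) → QuasiConstant f
  minuscule⇒quasi-constant {f} minuscule = orbit-bound⇒quasi-constant (λ _ → 1ℤ) (λ _ → 1ℤ)
    (λ _ _ → refl) (λ _ _ → refl) (λ _ ())
    (λ k → subst (_∈0± 1ℤ) (sym (ℤ.*-identityˡ (f k))) (∈[-1,0,1]⇒∈0± (minuscule k)))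

  -- With y / e the minuscule coweight, `weight-identity` bounds e * (f k * L k) by e * L i. So
  -- `L * f` is 0 or ± the constant L i, and `L` is constant on orbits.
  cominuscule⇒quasi-constantˣ : ∀ {ξ} → Cominusculeˣ ξ → QuasiConstant (on-coroots ξ)
  cominuscule⇒quasi-constantˣ {ξ} (Δ , i , basis , _ , weight , fraction y d , coweight , minuscule) =
    orbit-bound⇒quasi-constant L (λ _ → L i) L-· (λ _ _ → refl) L≢0 λ k →
      ∈0±-cancel {e} (λ ()) (subst₂ _∈0±_
        (trans (sym (identity k)) (cong (e *_) (ℤ.*-comm (on-coroots ξ k) (L k))))
        (trans (cong (_* e) (ℤ.*-identityˡ (L i))) (ℤ.*-comm (L i) e))
        (∈0±-scale (1ℤ * L i) (∈[-1,0,1]⇒∈0± (minuscule k))))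
    where
    e : ℤ
    e = + ℕ.suc d
    identity : ∀ k → e * (on-coroots ξ k * L k) ≡ 1ℤ * L i * ⟨ root k , y ⟩
    identity = weight-identity basis ξ y 1ℤ e (λ j∈Δ → δ⁻ (weight j∈Δ)) (λ j∈Δ → δ⁻ (coweight j∈Δ))

  -- The minuscule side is now the weight x / e, so the same identity shows that L i * f k is 0 or ±
  -- L k: the constant and the length trade places.
  cominuscule⇒quasi-constantʸ : ∀ {ν} → Cominusculeʸ ν → QuasiConstant (on-roots ν)
  cominuscule⇒quasi-constantʸ {ν} (Δ , i , basis , _ , coweight , fraction x d , weight , minuscule) =
    orbit-bound⇒quasi-constant (λ _ → L i) L (λ _ _ → refl) L-· (λ _ → L≢0 i) λ k →
      ∈0±-cancel {e} (λ ()) (subst₂ _∈0±_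
        (trans (ℤ.*-comm (L k) ⟨ x , coroot k ⟩) (trans (sym (ℤ.*-identityˡ _)) (trans (identity k) (ℤ.*-assoc e (L i) (on-roots ν k)))))
        (ℤ.*-comm (L k) e)
        (∈0±-scale (L k) (∈[-1,0,1]⇒∈0± {⟨ x , coroot k ⟩} (minuscule k))))
    where
    e : ℤ
    e = + ℕ.suc d
    identity : ∀ k → 1ℤ * (⟨ x , coroot k ⟩ * L k) ≡ e * L i * on-roots ν k
    identity = weight-identity basis x ν e 1ℤ (λ j∈Δ → δ⁻ (weight j∈Δ)) (λ j∈Δ → δ⁻ (coweight j∈Δ))

  multiple⇒quasi-constantˣ : ∀ χ → Multipleˣ χ → QuasiConstantˣ χ
  multiple⇒quasi-constantˣ χ (m , ξ , χ≈mξ , special) = Equivalence.from quasi-constantˣ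
    (quasi-constant-cong
      (λ k → sym (trans (Functional.⟦⟧-cong X (linearˡ (coroot k)) χ≈mξ) (Functional.scalar-homo X (linearˡ (coroot k)) m ξ)))
      (scale-quasi-constant m ([ minuscule⇒quasi-constant , cominuscule⇒quasi-constantˣ ]′ special)))

  multiple⇒quasi-constantʸ : ∀ μ → Multipleʸ μ → QuasiConstantʸ μ
  multiple⇒quasi-constantʸ μ (m , ν , μ≈mν , special) = Equivalence.from quasi-constantʸ
    (quasi-constant-cong
      (λ k → sym (trans (Functional.⟦⟧-cong Y (linearʳ (root k)) μ≈mν) (Functional.scalar-homo Y (linearʳ (root k)) m ν)))
      (scale-quasi-constant m ([ minuscule⇒quasi-constant , cominuscule⇒quasi-constantʸ ]′ special)))

theorem1p2p1 : ∀ {c ℓ} (R : RootDatum c ℓ) → IsSimple R → let open RootDatum R in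
    (SimplyConnected → ∀ χ →
    QuasiConstantˣ χ ⇔ (∃[ m ] ∃[ ξ ] χ X.≈ᴹ m X.*ₗ ξ × (Minusculeˣ (ι ξ) ⊎ Cominusculeˣ ξ)))
    ×
    (Adjoint → ∀ μ →
    QuasiConstantʸ μ ⇔ (∃[ m ] ∃[ ν ] μ Y.≈ᴹ m Y.*ₗ ν × (Minusculeʸ (ι ν) ⊎ Cominusculeʸ ν)))
theorem1p2p1 R isSimple =
  (λ simply-connected χ → mk⇔ (quasi-constant⇒multipleˣ simply-connected χ) (multiple⇒quasi-constantˣ χ)) ,
  (λ adjoint μ → mk⇔ (quasi-constant⇒multipleʸ adjoint μ) (multiple⇒quasi-constantʸ μ))
  where open Classification R isSimple
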